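{- For all integers $n,\alpha,\beta\ge0$ and $r,s\in\mathbb{Z}$, $${n-\beta\choose\alpha}_r+{n-\alpha\choose\beta}_s={n\choose\alpha+\beta}_{r+s}+\sum_{k=0}^{n}\ \sum_{\substack{\ell,m\ge0\\ \ell+m=k-1}}{n\choose k}_{r+s}{\ell\choose\alpha}_r{m\choose\beta}_s.$$
   Context: The Euler polynomials $E_n(x)$ are defined by $\frac{2e^{xt}}{e^t+1}=\sum_{n\ge0}E_n(x)\frac{t^n}{n!}$. For integers $N\ge0$, define ${N\brack j}$ by $\sum_{j=1}^N{N\brack j}x^{2j-1}=x^{2N}-E_{2N}(x)$ and ${N\brace j}$ by $\sum_{j=0}^N{N\brace j}x^{2j}=x^{2N+1}-E_{2N+1}(x)$; set ${N\brack j}=0$ if $j\le0$ or $j>N$, ${N\brace j}=0$ if $j<0$ or $j>N$. For $r\in\mathbb{Z}$ and integers $0\le i\le n$ define $${n\choose i}_r:=\begin{cases}{r/2+n\brack r/2+i}, & r\text{ even},\ n\ge\max\{0,-r/2\},\\ -{ -r/2-i\brack -r/2-n}, & r\text{ even},\ 0\le n<-r/2,\\ {(r-1)/2+n\brace (r-1)/2+i}, & r\text{ odd},\ n\ge\max\{0,-(r-1)/2\},\\ -{ -(r+1)/2-i\brace -(r+1)/2-n}, & r\text{ odd},\ 0\le n<-(r-1)/2,\end{cases}$$ and set ${n\choose i}_r:=0$ whenever $n<0$, $i<0$ or $i>n$. (Equivalently, for $0\le i\le n$, ${n\choose i}_r=f_{n-i+1}\binom{r+2n}{r+2i-1}$ if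 $n\ge\max\{0,\lceil -r/2\rceil\}$ and $-f_{n-i+1}\binom{ -r-2i}{ -r-2n-1}$ if $0\le n<\lceil -r/2\rceil$, where $f_m=\frac{4^m-1}{m}B_{2m}$ and $B_j$ are the Bernoulli numbers.) -}

module Defs where

open import Data.Bool using (if_then_else_; _∧_)
open import Data.Fin using (Fin; zero; suc; toℕ)
open import Data.Integer as ℤ using (ℤ; +_; 0ℤ; 1ℤ; ∣_∣; _/ℕ_; _%ℕ_)
open import Data.Nat as ℕ using (ℕ; zero; suc; _∸_; _!; _≡ᵇ_)
open import Data.Nat.Properties using (_!≢0)
open import Data.Rational using (ℚ; 0ℚ; 1ℚ; _+_; _*_; _-_; -_; _/_; 1/_; NonZero)
open import Data.Rational.Properties using (+-0-commutativeMonoid; +-assoc; +-identityʳ; +-inverseˡ; *-assoc; *-identityˡ; *-inverseʳ)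
open import Data.Vec using (Vec; []; _∷_; head; lookup)
open import Relation.Binary.PropositionalEquality using (_≡_; refl; sym; cong; module ≡-Reasoning)
open import Relation.Nullary.Decidable using (⌊_⌋)

-- ∑[ i < n ] and ∑[ i ≤ n ] bind i : Fin n and i : Fin (suc n) respectively.
open import Algebra.Properties.CommutativeMonoid.Sum +-0-commutativeMonoid public
  using (sum; sum-syntax; sum⁺-syntax; sum-cong-≗)

------------------------------------------------------------------------
-- Formal power series

-- g n is the coefficient of tⁿ.
Series : Set
Series = ℕ → ℚ

-- p j is the coefficient of xʲ.
Poly : Set
Poly = ℕ → ℚ

x^_ : ℕ → Poly
(x^ n) j = if n ≡ᵇ j then 1ℚ else 0ℚ

one : Series
one zero    = 1ℚ
one (suc _) = 0ℚ

infixl 7 _⊛_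

_⊛_ : Series → Series → Series
(f ⊛ g) n = ∑[ k ≤ n ] (f (toℕ k) * g (n ∸ toℕ k))

-- The first n coefficients of 1 / g, highest degree first: the coefficient h n
-- solves  g 0 * h n + ∑[ 1 ≤ k ≤ n ] g k * h (n ∸ k) = one n.
inverseCoeffs : (g : Series) → .{{NonZero (g 0)}} → (n : ℕ) → Vec ℚ n
inverseCoeffs g zero    = []
inverseCoeffs g (suc n) =
  (1/ g 0) * (one n - ∑[ k < n ] (g (suc (toℕ k)) * lookup (inverseCoeffs g n) k))
  ∷ inverseCoeffs g n

inverse : (g : Series) → .{{NonZero (g 0)}} → Series
inverse g n = head (inverseCoeffs g (suc n))

lookup-inverseCoeffs : (g : Series) .{{_ : NonZero (g 0)}} (n : ℕ) (k : Fin n) →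
                       lookup (inverseCoeffs g n) k ≡ inverse g (n ∸ suc (toℕ k))
lookup-inverseCoeffs g (suc n) zero    = refl
lookup-inverseCoeffs g (suc n) (suc k) = lookup-inverseCoeffs g n k

⊛-inverseʳ : (g : Series) .{{_ : NonZero (g 0)}} (n : ℕ) → (g ⊛ inverse g) n ≡ one n
⊛-inverseʳ g n = begin
  g 0 * inverse g n + ∑[ k < n ] (g (suc (toℕ k)) * inverse g (n ∸ suc (toℕ k)))
    ≡⟨ cong (λ c → g 0 * inverse g n + c) (sum-cong-≗ {n} λ k →
         cong (g (suc (toℕ k)) *_) (sym (lookup-inverseCoeffs g n k))) ⟩
  g 0 * ((1/ g 0) * (one n - S)) + S
    ≡⟨ cong (_+ S) (sym (*-assoc (g 0) (1/ g 0) (one n - S))) ⟩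
  (g 0 * 1/ g 0) * (one n - S) + S
    ≡⟨ cong (λ c → c * (one n - S) + S) (*-inverseʳ (g 0)) ⟩
  1ℚ * (one n - S) + S
    ≡⟨ cong (_+ S) (*-identityˡ (one n - S)) ⟩
  (one n - S) + S
    ≡⟨ +-assoc (one n) (- S) S ⟩
  one n + (- S + S)
    ≡⟨ cong (λ c → one n + c) (+-inverseˡ S) ⟩
  one n + 0ℚ
    ≡⟨ +-identityʳ (one n) ⟩
  one n ∎
  where
  open ≡-Reasoning
  S : ℚ
  S = ∑[ k < n ] (g (suc (toℕ k)) * lookup (inverseCoeffs g n) k)

------------------------------------------------------------------------
-- Euler polynomials

2ℚ : ℚ
2ℚ = + 2 / 1

-- eᵗ
exp : Series
exp n = (+ 1 / (n !)) {{n !≢0}}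

-- eᵗ + 1
exp+1 : Series
exp+1 n = exp n + one n

-- e^(xt), as a power series in t with coefficients in ℚ[x]
exp-xt : ℕ → Poly
exp-xt n j = exp n * (x^ n) j

-- 2 e^(xt) / (eᵗ + 1), as a power series in t with coefficients in ℚ[x]
eulerGF : ℕ → Poly
eulerGF n j = ((λ k → 2ℚ * exp-xt k j) ⊛ inverse exp+1) n

E : ℕ → Poly
E n j = (+ (n !) / 1) * eulerGF n j

------------------------------------------------------------------------
-- The numbers [N, j], {N, j} and the generalised binomials

-- [N, j] is the coefficient of x²ʲ⁻¹ in x²ᴺ - E_{2N}(x) for 1 ≤ j ≤ N, and 0
-- otherwise; for N < 0 no j qualifies.
brack : ℤ → ℤ → ℚ
brack N j =
  if ⌊ 1ℤ ℤ.≤? j ⌋ ∧ ⌊ j ℤ.≤? N ⌋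
  then (x^ (2 ℕ.* ∣ N ∣)) (2 ℕ.* ∣ j ∣ ∸ 1) - E (2 ℕ.* ∣ N ∣) (2 ℕ.* ∣ j ∣ ∸ 1)
  else 0ℚ

-- {N, j} is the coefficient of x²ʲ in x²ᴺ⁺¹ - E_{2N+1}(x) for 0 ≤ j ≤ N, and 0
-- otherwise; for N < 0 no j qualifies.
brace : ℤ → ℤ → ℚ
brace N j =
  if ⌊ 0ℤ ℤ.≤? j ⌋ ∧ ⌊ j ℤ.≤? N ⌋
  then (x^ (2 ℕ.* ∣ N ∣ ℕ.+ 1)) (2 ℕ.* ∣ j ∣) - E (2 ℕ.* ∣ N ∣ ℕ.+ 1) (2 ℕ.* ∣ j ∣)
  else 0ℚ

infix 8 _choose_at_

-- n choose i at r  is the binomial (n over i) with subscript r.  Every division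
-- by 2 below is exact.
_choose_at_ : ℤ → ℤ → ℤ → ℚ
n choose i at r =
  if ⌊ 0ℤ ℤ.≤? n ⌋ ∧ ⌊ 0ℤ ℤ.≤? i ⌋ ∧ ⌊ i ℤ.≤? n ⌋
  then (if ⌊ r %ℕ 2 ℕ.≟ 0 ⌋ then even else odd)
  else 0ℚ
  where
  even odd : ℚ
  even = if ⌊ 0ℤ ℤ.⊔ (ℤ.- (r /ℕ 2)) ℤ.≤? n ⌋
         then brack (r /ℕ 2 ℤ.+ n) (r /ℕ 2 ℤ.+ i)
         else - brack (ℤ.- (r /ℕ 2) ℤ.- i) (ℤ.- (r /ℕ 2) ℤ.- n)
  odd  = if ⌊ 0ℤ ℤ.⊔ (ℤ.- ((r ℤ.- 1ℤ) /ℕ 2)) ℤ.≤? n ⌋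
         then brace ((r ℤ.- 1ℤ) /ℕ 2 ℤ.+ n) ((r ℤ.- 1ℤ) /ℕ 2 ℤ.+ i)
         else - brace (ℤ.- ((r ℤ.+ 1ℤ) /ℕ 2) ℤ.- i) (ℤ.- ((r ℤ.+ 1ℤ) /ℕ 2) ℤ.- n)

{-# OPTIONS --safe #-}
module Submission where

-- Write T(t) = (eᵗ - 1)/(eᵗ + 1) = tanh(t/2) and T_m for its coefficients.  Since
-- xᴺ - E_N(x) = T(d/dx) xᴺ, all four cases of the definition collapse to
--
--   (i + d) choose i at r  =  T_{2d+1} · (r + 2i)(r + 2i + 1) ⋯ (r + 2i + 2d).
--
-- The addition formula T(x) + T(y) = T(x + y) + T(x) T(y) T(x + y), read off in
-- degree M = 2d + 1, is an identity between binary forms in x and y.  Put a = r + 2α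
-- and b = s + 2β.  The theorem for n = α + β + d is its image under the linear map
-- sending xᵖ y^q (x + y)ʷ, p + q + w = M, to
--
--   F p q w  =  a(a+1)⋯(a+p-1) · b(b+1)⋯(b+q-1) · (a+b+p+q)(a+b+p+q+1)⋯(a+b+M-1),
--
-- a normalised beta integral of uᵖ (1 - u)^q.  The map is well defined because
-- F p q (w + 1) = F (p + 1) q w + F p (q + 1) w, and T is odd, so only odd p, q, w occur.

open import Algebra.Bundles using (CommutativeRing; CommutativeSemiring)
open import Algebra.Morphism.Structures using (module SemiringMorphisms)
import Algebra.Morphism.Construct.Identity as Identity
import Algebra.Properties.CommutativeSemigroup as CommutativeSemigroupProperties
import Algebra.Properties.CommutativeSemiring.Binomial as Binomial
import Algebra.Properties.CommutativeSemiring.Exp as Exponentiation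
open import Algebra.Properties.Group using (⁻¹-involutive)
import Algebra.Properties.Semiring.Mult as Multiples
import Algebra.Properties.Semiring.Sum as SemiringSum
import Algebra.Solver.Ring.NaturalCoefficients.Default as SemiringSolver
open import Algebra.Structures.Biased using (isCommutativeSemiringˡ)
open import Data.Bool using (true; false; if_then_else_)
open import Data.Fin using (Fin; zero; suc; toℕ)
open import Data.Fin.Properties using (toℕ≤pred[n])
open import Data.Integer as ℤ using (ℤ; +_; -[1+_]; 0ℤ; 1ℤ; -1ℤ; _/ℕ_; _%ℕ_)
open import Data.Integer.DivMod using (a≡a%ℕn+[a/ℕn]*n; n%ℕd<d)
import Data.Integer.Properties as ℤ
import Data.Integer.Tactic.RingSolver as ℤ
open import Data.Nat as ℕ using (ℕ; zero; suc; _∸_; _!; s≤s; z≤n)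
open import Data.Nat.Combinatorics using (_C_; nCk≡n!/k![n-k]!; k![n∸k]!∣n!)
import Data.Nat.DivMod as ℕ
import Data.Nat.Properties as ℕ
import Data.Nat.Tactic.RingSolver as ℕ
open import Data.Product using (_,_)
open import Data.Rational as ℚ using (ℚ; 0ℚ; 1ℚ; ½; toℚᵘ)
import Data.Rational.Properties as ℚ
open import Data.Rational.Unnormalised as ℚᵘ using (mkℚᵘ; *≡*)
import Data.Rational.Unnormalised.Properties as ℚᵘ
open import Function using (_∘_; id)
import Relation.Binary.PropositionalEquality as ≡
import Relation.Binary.Reasoning.Setoid as SetoidReasoning
open import Relation.Nullary using (Dec; yes; no; ¬_; contradiction)
open import Relation.Nullary.Decidable using (⌊_⌋; isYes≗does; dec-true; dec-false)

-- Formal power series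

-- The beta integral converges only for positive a and b, while r and s are arbitrary integers. Only
-- its recurrence is therefore used, and that is a polynomial identity in a and b. The products of
-- powers of x, y and x + y are linearly dependent, so the map is defined on monomials alone, with y
-- set to 1, and its values on the other products are deduced from the recurrence.
--
-- One closed formula covers all the cases because of two properties of rising factorials. One that
-- passes through 0 vanishes, which reproduces the zero convention for indices out of range.
-- Reversing one of odd length 2d + 1 changes its sign, which produces the minus sign in the
-- definition for very negative r.
--
-- Series are taken over commutative semirings so that the construction can be iterated: the
-- addition formula is needed over ℚ, for the oddness of T, and over ℚ[[x]], for the identity
-- between forms.

module PowerSeries {c ℓ} (K : CommutativeSemiring c ℓ) where
  open CommutativeSemiring K
  open SemiringSum semiring using (sum⁺-syntax)
  open SetoidReasoning setoid
  private
    module +-Properties = CommutativeSemigroupProperties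
      (CommutativeSemiring.+-commutativeSemigroup K)

  PS : Set c
  PS = ℕ → Carrier

  infix 4 _≋_
  _≋_ : PS → PS → Set ℓ
  f ≋ g = ∀ n → f n ≈ g n

  infixl 6 _⊞_
  _⊞_ : PS → PS → PS
  (f ⊞ g) n = f n + g n

  infixl 7 _⋆_
  -- Over ℚ this unfolds to the same sum as `_⊛_`, so the two products are interchanged below
  -- without proof.
  _⋆_ : PS → PS → PS
  (f ⋆ g) n = ∑[ k ≤ n ] (f (toℕ k) * g (n ∸ toℕ k))

  infixr 7 _•_
  _•_ : Carrier → PS → PS
  (a • f) n = a * f n

  𝟘 : PS
  𝟘 _ = 0#

  shift : PS → PS
  shift f zero    = 0#
  shift f (suc n) = f n

  const : Carrier → PS
  const a zero    = a
  const a (suc _) = 0#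

  𝟙 : PS
  𝟙 = const 1#

  𝐱 : PS
  𝐱 = shift 𝟙

  ⋆-cong : ∀ {f f′ g g′} → f ≋ f′ → g ≋ g′ → f ⋆ g ≋ f′ ⋆ g′
  ⋆-cong p q zero    = +-congʳ (*-cong (p 0) (q 0))
  ⋆-cong p q (suc n) = +-cong (*-cong (p 0) (q (suc n))) (⋆-cong (p ∘ suc) q n)

  𝟘-⋆ : ∀ g → 𝟘 ⋆ g ≋ 𝟘
  𝟘-⋆ g zero    = trans (+-identityʳ _) (zeroˡ _)
  𝟘-⋆ g (suc n) = trans (+-cong (zeroˡ _) (𝟘-⋆ g n)) (+-identityˡ _)

  ⋆-distribʳ : ∀ h f g → (f ⊞ g) ⋆ h ≋ (f ⋆ h) ⊞ (g ⋆ h)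
  ⋆-distribʳ h f g zero    = begin
    (f 0 + g 0) * h 0 + 0#              ≈⟨ +-identityʳ _ ⟩
    (f 0 + g 0) * h 0                   ≈⟨ distribʳ _ _ _ ⟩
    f 0 * h 0 + g 0 * h 0               ≈⟨ +-cong (+-identityʳ _) (+-identityʳ _) ⟨
    (f 0 * h 0 + 0#) + (g 0 * h 0 + 0#) ∎
  ⋆-distribʳ h f g (suc n) = begin
    (f 0 + g 0) * h (suc n) + ((f ⊞ g) ∘ suc ⋆ h) n
      ≈⟨ +-cong (distribʳ _ _ _) (⋆-distribʳ h (f ∘ suc) (g ∘ suc) n) ⟩
    (f 0 * h (suc n) + g 0 * h (suc n)) + ((f ∘ suc ⋆ h) n + (g ∘ suc ⋆ h) n)
      ≈⟨ +-Properties.interchange _ _ _ _ ⟩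
    (f ⋆ h) (suc n) + (g ⋆ h) (suc n) ∎

  •-⋆ : ∀ a f g → (a • f) ⋆ g ≋ a • (f ⋆ g)
  •-⋆ a f g zero    = begin
    (a * f 0) * g 0 + 0# ≈⟨ +-identityʳ _ ⟩
    (a * f 0) * g 0      ≈⟨ *-assoc _ _ _ ⟩
    a * (f 0 * g 0)      ≈⟨ *-congˡ (+-identityʳ _) ⟨
    a * (f 0 * g 0 + 0#) ∎
  •-⋆ a f g (suc n) = begin
    (a * f 0) * g (suc n) + ((a • f) ∘ suc ⋆ g) n ≈⟨ +-cong (*-assoc _ _ _) (•-⋆ a (f ∘ suc) g n) ⟩
    a * (f 0 * g (suc n)) + a * (f ∘ suc ⋆ g) n   ≈⟨ distribˡ _ _ _ ⟨
    a * (f ⋆ g) (suc n)                           ∎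

  -- The sum unfolds by splitting off the constant term of f. Commutativity also needs the mirror
  -- image, in which the constant term of g is split off.
  ⋆-last : ∀ f g n → (f ⋆ g) (suc n) ≈ f (suc n) * g 0 + (f ⋆ (g ∘ suc)) n
  ⋆-last f g zero    = begin
    f 0 * g 1 + (f 1 * g 0 + 0#) ≈⟨ +-congˡ (+-identityʳ _) ⟩
    f 0 * g 1 + f 1 * g 0        ≈⟨ +-comm _ _ ⟩
    f 1 * g 0 + f 0 * g 1        ≈⟨ +-congˡ (+-identityʳ _) ⟨
    f 1 * g 0 + (f 0 * g 1 + 0#) ∎
  ⋆-last f g (suc n) = begin
    f 0 * g (suc (suc n)) + (f ∘ suc ⋆ g) (suc n)
      ≈⟨ +-congˡ (⋆-last (f ∘ suc) g n) ⟩
    f 0 * g (suc (suc n)) + (f (suc (suc n)) * g 0 + (f ∘ suc ⋆ g ∘ suc) n)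
      ≈⟨ +-Properties.x∙yz≈y∙xz _ _ _ ⟩
    f (suc (suc n)) * g 0 + (f ⋆ (g ∘ suc)) (suc n) ∎

  ⋆-comm : ∀ f g → f ⋆ g ≋ g ⋆ f
  ⋆-comm f g zero    = +-congʳ (*-comm _ _)
  ⋆-comm f g (suc n) = begin
    f 0 * g (suc n) + (f ∘ suc ⋆ g) n ≈⟨ +-cong (*-comm _ _) (⋆-comm (f ∘ suc) g n) ⟩
    g (suc n) * f 0 + (g ⋆ f ∘ suc) n ≈⟨ ⋆-last g f n ⟨
    (g ⋆ f) (suc n)                   ∎

  ⋆-assoc : ∀ f g h → (f ⋆ g) ⋆ h ≋ f ⋆ (g ⋆ h)
  ⋆-assoc f g h zero    = +-congʳ (begin
    (f 0 * g 0 + 0#) * h 0 ≈⟨ *-congʳ (+-identityʳ _) ⟩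
    (f 0 * g 0) * h 0      ≈⟨ *-assoc _ _ _ ⟩
    f 0 * (g 0 * h 0)      ≈⟨ *-congˡ (+-identityʳ _) ⟨
    f 0 * (g 0 * h 0 + 0#) ∎)
  ⋆-assoc f g h (suc n) = begin
    (f 0 * g 0 + 0#) * h (suc n) + (((f 0 • (g ∘ suc)) ⊞ (f ∘ suc ⋆ g)) ⋆ h) n
      ≈⟨ +-cong (trans (*-congʳ (+-identityʳ _)) (*-assoc _ _ _)) (⋆-distribʳ h (f 0 • (g ∘ suc)) (f ∘ suc ⋆ g) n) ⟩
    f 0 * (g 0 * h (suc n)) + (((f 0 • (g ∘ suc)) ⋆ h) n + ((f ∘ suc ⋆ g) ⋆ h) n)
      ≈⟨ +-congˡ (+-cong (•-⋆ (f 0) (g ∘ suc) h n) (⋆-assoc (f ∘ suc) g h n)) ⟩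
    f 0 * (g 0 * h (suc n)) + (f 0 * (g ∘ suc ⋆ h) n + (f ∘ suc ⋆ (g ⋆ h)) n)
      ≈⟨ +-assoc _ _ _ ⟨
    (f 0 * (g 0 * h (suc n)) + f 0 * (g ∘ suc ⋆ h) n) + (f ∘ suc ⋆ (g ⋆ h)) n
      ≈⟨ +-congʳ (distribˡ _ _ _) ⟨
    (f ⋆ (g ⋆ h)) (suc n) ∎

  const-⋆ : ∀ a g → const a ⋆ g ≋ a • g
  const-⋆ a g zero    = +-identityʳ _
  const-⋆ a g (suc n) = trans (+-congˡ (𝟘-⋆ g n)) (+-identityʳ _)

  ⋆-identityˡ : ∀ g → 𝟙 ⋆ g ≋ g
  ⋆-identityˡ g n = trans (const-⋆ 1# g n) (*-identityˡ _)

  shift-⋆ : ∀ f g → shift f ⋆ g ≋ shift (f ⋆ g)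
  shift-⋆ f g zero    = trans (+-identityʳ _) (zeroˡ _)
  shift-⋆ f g (suc n) = trans (+-congʳ (zeroˡ _)) (+-identityˡ _)

  shift-cong : ∀ {f g} → f ≋ g → shift f ≋ shift g
  shift-cong p zero    = refl
  shift-cong p (suc n) = p n

  𝐱-⋆ : ∀ g → 𝐱 ⋆ g ≋ shift g
  𝐱-⋆ g n = trans (shift-⋆ 𝟙 g n) (shift-cong (⋆-identityˡ g) n)

  powerSeries : CommutativeSemiring c ℓ
  powerSeries = record
    { Carrier = PS
    ; _≈_ = _≋_
    ; _+_ = _⊞_
    ; _*_ = _⋆_
    ; 0# = 𝟘
    ; 1# = 𝟙
    ; isCommutativeSemiring = isCommutativeSemiringˡ record
      { +-isCommutativeMonoid = record
        { isMonoid = record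
          { isSemigroup = record
            { isMagma = record
              { isEquivalence = record
                { refl  = λ _ → refl
                ; sym   = λ p n → sym (p n)
                ; trans = λ p q n → trans (p n) (q n)
                }
              ; ∙-cong = λ p q n → +-cong (p n) (q n)
              }
            ; assoc = λ f g h n → +-assoc (f n) (g n) (h n)
            }
          ; identity = (λ f n → +-identityˡ (f n)) , (λ f n → +-identityʳ (f n))
          }
        ; comm = λ f g n → +-comm (f n) (g n)
        }
      ; *-isCommutativeMonoid = record
        { isMonoid = record
          { isSemigroup = record
            { isMagma = record
              { isEquivalence = record
                { refl  = λ _ → refl
                ; sym   = λ p n → sym (p n)
                ; trans = λ p q n → trans (p n) (q n)
                }
              ; ∙-cong = ⋆-cong
              }
            ; assoc = ⋆-assoc
            }
          ; identity = ⋆-identityˡ , λ f n → trans (⋆-comm f 𝟙 n) (⋆-identityˡ f n)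
          }
        ; comm = ⋆-comm
        }
      ; distribʳ = ⋆-distribʳ
      ; zeroˡ = 𝟘-⋆
      }
    }

-- Rescaling f(t) ↦ f(ct)

module Scaling {a b ℓ₁ ℓ₂} (K : CommutativeSemiring a ℓ₁) (A : CommutativeSemiring b ℓ₂)
  (ι : CommutativeSemiring.Carrier K → CommutativeSemiring.Carrier A)
  (hom : SemiringMorphisms.IsSemiringHomomorphism
    (CommutativeSemiring.rawSemiring K) (CommutativeSemiring.rawSemiring A) ι) where
  private
    module K = CommutativeSemiring K
    module K⟦t⟧ = PowerSeries K
    module *-Properties = CommutativeSemigroupProperties
      (CommutativeSemiring.*-commutativeSemigroup A)
  open SemiringMorphisms.IsSemiringHomomorphism hom
  open CommutativeSemiring A
  open Exponentiation A using (_^_)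
  open PowerSeries A
  open SetoidReasoning setoid

  -- Coefficients are transported along ι, so c may lie in a larger semiring. With c an
  -- indeterminate x, the coefficient of the n-th power of t becomes a monomial of degree n in x.
  scale : Carrier → K⟦t⟧.PS → PS
  scale c f n = ι (f n) * c ^ n

  scale-cong : ∀ c {f g} → f K⟦t⟧.≋ g → scale c f ≋ scale c g
  scale-cong c p n = *-congʳ (⟦⟧-cong (p n))

  scale-⊞ : ∀ c f g → scale c (f K⟦t⟧.⊞ g) ≋ scale c f ⊞ scale c g
  scale-⊞ c f g n = trans (*-congʳ (+-homo (f n) (g n))) (distribʳ _ _ _)

  scale-𝟙 : ∀ c → scale c K⟦t⟧.𝟙 ≋ 𝟙
  scale-𝟙 c zero    = trans (*-congʳ 1#-homo) (*-identityˡ _)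
  scale-𝟙 c (suc n) = trans (*-congʳ 0#-homo) (zeroˡ _)

  scale-⋆ : ∀ c f g → scale c (f K⟦t⟧.⋆ g) ≋ scale c f ⋆ scale c g
  scale-⋆ c f g zero    = begin
    ι (f 0 K.* g 0 K.+ K.0#) * 1#            ≈⟨ *-identityʳ _ ⟩
    ι (f 0 K.* g 0 K.+ K.0#)                 ≈⟨ ⟦⟧-cong (K.+-identityʳ _) ⟩
    ι (f 0 K.* g 0)                          ≈⟨ *-homo _ _ ⟩
    ι (f 0) * ι (g 0)                        ≈⟨ *-cong (*-identityʳ _) (*-identityʳ _) ⟨
    (ι (f 0) * 1#) * (ι (g 0) * 1#)          ≈⟨ +-identityʳ _ ⟨
    (ι (f 0) * 1#) * (ι (g 0) * 1#) + 0#     ∎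
  scale-⋆ c f g (suc n) = begin
    ι (f 0 K.* g (suc n) K.+ (f ∘ suc K⟦t⟧.⋆ g) n) * (c * c ^ n)
      ≈⟨ *-congʳ (+-homo _ _) ⟩
    (ι (f 0 K.* g (suc n)) + ι ((f ∘ suc K⟦t⟧.⋆ g) n)) * (c * c ^ n)
      ≈⟨ distribʳ _ _ _ ⟩
    ι (f 0 K.* g (suc n)) * (c * c ^ n) + ι ((f ∘ suc K⟦t⟧.⋆ g) n) * (c * c ^ n)
      ≈⟨ +-cong (*-congʳ (*-homo _ _)) (*-Properties.x∙yz≈y∙xz _ _ _) ⟩
    (ι (f 0) * ι (g (suc n))) * (c * c ^ n) + c * scale c (f ∘ suc K⟦t⟧.⋆ g) n
      ≈⟨ +-cong (trans (*-assoc _ _ _) (*-congʳ (sym (*-identityʳ _)))) (*-congˡ (scale-⋆ c (f ∘ suc) g n)) ⟩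
    scale c f 0 * scale c g (suc n) + c * (scale c (f ∘ suc) ⋆ scale c g) n
      ≈⟨ +-congˡ (•-⋆ c (scale c (f ∘ suc)) (scale c g) n) ⟨
    scale c f 0 * scale c g (suc n) + ((c • scale c (f ∘ suc)) ⋆ scale c g) n
      ≈⟨ +-congˡ (⋆-cong {g = scale c g} (λ k → *-Properties.x∙yz≈y∙xz c (ι (f (suc k))) (c ^ k)) (λ _ → refl) n) ⟩
    (scale c f ⋆ scale c g) (suc n) ∎

module TanhAlgebra {c ℓ} (S : CommutativeSemiring c ℓ) where
  open CommutativeSemiring S
  open SetoidReasoning setoid

  -- x, y, z stand for eᵘ - 1, eᵛ - 1, eᵘ⁺ᵛ - 1 and p, q, r for 1/(eᵘ + 1), 1/(eᵛ + 1),
  -- 1/(eᵘ⁺ᵛ + 1); in these terms no subtraction occurs.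
  tanh-addition : ∀ x y z p q r → z ≈ x + y + x * y →
    (1# + 1# + x) * p ≈ 1# → (1# + 1# + y) * q ≈ 1# → (1# + 1# + z) * r ≈ 1# →
    x * p + y * q ≈ z * r + ((x * p) * (y * q)) * (z * r)
  tanh-addition x y z p q r z≈ xp yq zr = begin
    x * p + y * q
      ≈⟨ +-cong (*-identityʳ _) (*-identityʳ _) ⟨
    x * p * 1# + y * q * 1#
      ≈⟨ +-cong (*-congˡ yq) (*-congˡ xp) ⟨
    x * p * ((1# + 1# + y) * q) + y * q * ((1# + 1# + x) * p)
      ≈⟨ solve 4 (λ x y p q → x :* p :* ((con 1 :+ con 1 :+ y) :* q) :+ y :* q :* ((con 1 :+ con 1 :+ x) :* p)
           := con 2 :* (x :+ y :+ x :* y) :* (p :* q)) refl x y p q ⟩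
    2# * (x + y + x * y) * (p * q)
      ≈⟨ *-congʳ (*-congˡ z≈) ⟨
    2# * z * (p * q)
      ≈⟨ trans (*-congˡ zr) (*-identityʳ _) ⟨
    2# * z * (p * q) * ((1# + 1# + z) * r)
      ≈⟨ solve 4 (λ z p q r → con 2 :* z :* (p :* q) :* ((con 1 :+ con 1 :+ z) :* r)
           := z :* r :* (p :* q :* (con 2 :* (con 2 :+ z)))) refl z p q r ⟩
    z * r * (p * q * (2# * (2# + z)))
      ≈⟨ *-congˡ (*-congˡ (*-congˡ (+-congˡ z≈))) ⟩
    z * r * (p * q * (2# * (2# + (x + y + x * y))))
      -- The identity at work is 2(2 + x + y + xy) = (2 + x)(2 + y) + xy: the first summand cancels
      -- against p q, the second gives the triple product.
      ≈⟨ solve 6 (λ x y z p q r → z :* r :* (p :* q :* (con 2 :* (con 2 :+ (x :+ y :+ x :* y))))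
           := z :* r :* ((con 1 :+ con 1 :+ x) :* p :* ((con 1 :+ con 1 :+ y) :* q)) :+ ((x :* p) :* (y :* q)) :* (z :* r))
         refl x y z p q r ⟩
    z * r * ((1# + 1# + x) * p * ((1# + 1# + y) * q)) + ((x * p) * (y * q)) * (z * r)
      ≈⟨ +-congʳ (*-congˡ (trans (*-cong xp yq) (*-identityʳ _))) ⟩
    z * r * 1# + ((x * p) * (y * q)) * (z * r)
      ≈⟨ +-congʳ (*-identityʳ _) ⟩
    z * r + ((x * p) * (y * q)) * (z * r) ∎
    where
    open SemiringSolver S
    2# : Carrier
    2# = 1# + 1#

open import Defs

ℚ-semiring : CommutativeSemiring _ _
ℚ-semiring = CommutativeRing.commutativeSemiring ℚ.+-*-commutativeRing

module ℚ⟦x⟧ = PowerSeries ℚ-semiring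

-- Exponential series

module _ where
  open import Data.Rational using (_+_; _*_; _/_)
  open import Relation.Binary.PropositionalEquality using (_≡_; refl; sym; trans; cong; cong₂; module ≡-Reasoning)

  fromℤ : ℤ → ℚ
  fromℤ i = i / 1

  fromℤ-homo-+ : ∀ i j → fromℤ (i ℤ.+ j) ≡ fromℤ i + fromℤ j
  fromℤ-homo-+ i j = ℚ.toℚᵘ-injective (begin
    toℚᵘ (fromℤ (i ℤ.+ j))                ≈⟨ ℚ.toℚᵘ-fromℚᵘ (mkℚᵘ (i ℤ.+ j) 0) ⟩
    mkℚᵘ (i ℤ.+ j) 0                      ≈⟨ *≡* (cong (ℤ._* 1ℤ) (cong₂ ℤ._+_ (sym (ℤ.*-identityʳ i)) (sym (ℤ.*-identityʳ j)))) ⟩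
    mkℚᵘ i 0 ℚᵘ.+ mkℚᵘ j 0                ≈⟨ ℚᵘ.+-cong (ℚ.toℚᵘ-fromℚᵘ (mkℚᵘ i 0)) (ℚ.toℚᵘ-fromℚᵘ (mkℚᵘ j 0)) ⟨
    toℚᵘ (fromℤ i) ℚᵘ.+ toℚᵘ (fromℤ j)    ≈⟨ ℚ.toℚᵘ-homo-+ (fromℤ i) (fromℤ j) ⟨
    toℚᵘ (fromℤ i + fromℤ j)              ∎)
    where open SetoidReasoning ℚᵘ.≃-setoid

  fromℤ-homo-* : ∀ i j → fromℤ (i ℤ.* j) ≡ fromℤ i * fromℤ j
  fromℤ-homo-* i j = ℚ.toℚᵘ-injective (begin
    toℚᵘ (fromℤ (i ℤ.* j))                ≈⟨ ℚ.toℚᵘ-fromℚᵘ (mkℚᵘ (i ℤ.* j) 0) ⟩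
    mkℚᵘ (i ℤ.* j) 0                      ≈⟨ *≡* refl ⟩
    mkℚᵘ i 0 ℚᵘ.* mkℚᵘ j 0                ≈⟨ ℚᵘ.*-cong (ℚ.toℚᵘ-fromℚᵘ (mkℚᵘ i 0)) (ℚ.toℚᵘ-fromℚᵘ (mkℚᵘ j 0)) ⟨
    toℚᵘ (fromℤ i) ℚᵘ.* toℚᵘ (fromℤ j)    ≈⟨ ℚ.toℚᵘ-homo-* (fromℤ i) (fromℤ j) ⟨
    toℚᵘ (fromℤ i * fromℤ j)              ∎)
    where open SetoidReasoning ℚᵘ.≃-setoid

  fromℕ : ℕ → ℚ
  fromℕ n = fromℤ (+ n)

  fromℕ-homo-* : ∀ m n → fromℕ (m ℕ.* n) ≡ fromℕ m * fromℕ n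
  fromℕ-homo-* m n = trans (cong fromℤ (ℤ.pos-* m n)) (fromℤ-homo-* (+ m) (+ n))

  1/n*n≡1 : ∀ n .{{_ : ℕ.NonZero n}} → (+ 1 / n) * fromℕ n ≡ 1ℚ
  1/n*n≡1 (suc n) = ℚ.toℚᵘ-injective (begin
    toℚᵘ ((+ 1 / suc n) * fromℕ (suc n))           ≈⟨ ℚ.toℚᵘ-homo-* (+ 1 / suc n) (fromℕ (suc n)) ⟩
    toℚᵘ (+ 1 / suc n) ℚᵘ.* toℚᵘ (fromℕ (suc n))   ≈⟨ ℚᵘ.*-cong (ℚ.toℚᵘ-fromℚᵘ (mkℚᵘ (+ 1) n)) (ℚ.toℚᵘ-fromℚᵘ (mkℚᵘ (+ suc n) 0)) ⟩
    mkℚᵘ (+ 1) n ℚᵘ.* mkℚᵘ (+ suc n) 0             ≈⟨ *≡* (trans (ℤ.*-identityʳ _) (cong (λ m → 1ℤ ℤ.* (+ m)) (sym (ℕ.*-identityʳ (suc n))))) ⟩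
    ℚᵘ.1ℚᵘ                                         ∎)
    where open SetoidReasoning ℚᵘ.≃-setoid

  exp*! : ∀ n → exp n * fromℕ (n !) ≡ 1ℚ
  exp*! n = 1/n*n≡1 (n !) {{n ℕ.!≢0}}

  C*![-]! : ∀ {n k} → k ℕ.≤ n → (n C k) ℕ.* (k ! ℕ.* (n ∸ k) !) ≡ n !
  C*![-]! {n} {k} k≤n = trans
    (cong (ℕ._* (k ! ℕ.* (n ∸ k) !)) (nCk≡n!/k![n-k]! k≤n))
    (ℕ.m/n*n≡m (k![n∸k]!∣n! k≤n))
    where instance _ = k ℕ.!* (n ∸ k) !≢0

  -- Inserting 1 = n!/n! and writing n! as C(n,k) k! (n-k)! lets each factorial cancel against its
  -- own reciprocal.
  exp*exp : ∀ {n k} → k ℕ.≤ n → exp k * exp (n ∸ k) ≡ exp n * fromℕ (n C k)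
  exp*exp {n} {k} k≤n = begin
    exp k * exp (n ∸ k)
      ≡⟨ ℚ.*-identityˡ _ ⟨
    1ℚ * (exp k * exp (n ∸ k))
      ≡⟨ cong (_* (exp k * exp (n ∸ k))) (exp*! n) ⟨
    exp n * fromℕ (n !) * (exp k * exp (n ∸ k))
      ≡⟨ cong (λ c → exp n * c * (exp k * exp (n ∸ k))) n!≡ ⟩
    exp n * (fromℕ (n C k) * (fromℕ (k !) * fromℕ ((n ∸ k) !))) * (exp k * exp (n ∸ k))
      ≡⟨ rearrange (exp n) (fromℕ (n C k)) (fromℕ (k !)) (fromℕ ((n ∸ k) !)) (exp k) (exp (n ∸ k)) ⟩
    exp n * fromℕ (n C k) * ((exp k * fromℕ (k !)) * (exp (n ∸ k) * fromℕ ((n ∸ k) !)))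
      ≡⟨ cong (exp n * fromℕ (n C k) *_) (cong₂ _*_ (exp*! k) (exp*! (n ∸ k))) ⟩
    exp n * fromℕ (n C k) * (1ℚ * 1ℚ)
      ≡⟨ ℚ.*-identityʳ _ ⟩
    exp n * fromℕ (n C k) ∎
    where
    open ≡-Reasoning
    open SemiringSolver ℚ-semiring
    n!≡ : fromℕ (n !) ≡ fromℕ (n C k) * (fromℕ (k !) * fromℕ ((n ∸ k) !))
    n!≡ = begin
      fromℕ (n !)                                   ≡⟨ cong fromℕ (C*![-]! k≤n) ⟨
      fromℕ ((n C k) ℕ.* (k ! ℕ.* (n ∸ k) !))       ≡⟨ fromℕ-homo-* (n C k) _ ⟩
      fromℕ (n C k) * fromℕ (k ! ℕ.* (n ∸ k) !)     ≡⟨ cong (fromℕ (n C k) *_) (fromℕ-homo-* (k !) _) ⟩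
      fromℕ (n C k) * (fromℕ (k !) * fromℕ ((n ∸ k) !)) ∎
    rearrange : ∀ e c a b x y → e * (c * (a * b)) * (x * y) ≡ e * c * ((x * a) * (y * b))
    rearrange = solve 6 (λ e c a b x y → e :* (c :* (a :* b)) :* (x :* y) := e :* c :* ((x :* a) :* (y :* b))) refl

-- Addition formula for tanh

expm1 : Series
expm1 zero    = 0ℚ
expm1 (suc n) = exp (suc n)

-- (eᵗ - 1) / (eᵗ + 1) = tanh (t / 2)
tanh½ : Series
tanh½ = expm1 ⊛ inverse exp+1

exp≋1+expm1 : exp ℚ⟦x⟧.≋ ℚ⟦x⟧.𝟙 ℚ⟦x⟧.⊞ expm1
exp≋1+expm1 zero    = ≡.refl
exp≋1+expm1 (suc n) = ≡.sym (ℚ.+-identityˡ (exp (suc n)))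

exp+1≋2+expm1 : exp+1 ℚ⟦x⟧.≋ ℚ⟦x⟧.𝟙 ℚ⟦x⟧.⊞ ℚ⟦x⟧.𝟙 ℚ⟦x⟧.⊞ expm1
exp+1≋2+expm1 zero    = ≡.refl
exp+1≋2+expm1 (suc n) = ≡.trans (ℚ.+-identityʳ (exp (suc n))) (≡.sym (ℚ.+-identityˡ (exp (suc n))))

exp+1-inverse : exp+1 ⊛ inverse exp+1 ℚ⟦x⟧.≋ ℚ⟦x⟧.𝟙
exp+1-inverse n = ≡.trans (⊛-inverseʳ exp+1 n) (one≋𝟙 n)
  where
  one≋𝟙 : one ℚ⟦x⟧.≋ ℚ⟦x⟧.𝟙
  one≋𝟙 zero    = ≡.refl
  one≋𝟙 (suc n) = ≡.refl

-- Instantiated twice: at A = ℚ with u = -1 and v = 1, where u + v = 0 yields oddness, and at A =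
-- ℚ[[x]] with u = x and v = 1, where each degree in t is a dehomogenised binary form.
module AdditionLaw {a ℓ} (A : CommutativeSemiring a ℓ)
  (ι : ℚ → CommutativeSemiring.Carrier A)
  (hom : SemiringMorphisms.IsSemiringHomomorphism
    (CommutativeSemiring.rawSemiring ℚ-semiring) (CommutativeSemiring.rawSemiring A) ι)
  (u v : CommutativeSemiring.Carrier A) where

  open CommutativeSemiring A
  open SemiringMorphisms.IsSemiringHomomorphism hom
  open Scaling ℚ-semiring A ι hom public
  open Exponentiation A using (_^_)
  open Multiples semiring using (_×_)
  private
    module A⟦t⟧ = PowerSeries A
    module Law where
      module ∑ = SemiringSum semiring
      open SetoidReasoning setoid

      -- Bridges the rational coefficients of the series and the natural multiples in which the
      -- binomial theorem is stated.
      ι-fromℕ : ∀ n x → ι (fromℕ n) * x ≈ n × x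
      ι-fromℕ zero    x = trans (*-congʳ 0#-homo) (zeroˡ x)
      ι-fromℕ (suc n) x = begin
        ι (fromℕ (suc n)) * x          ≈⟨ *-congʳ (⟦⟧-cong (fromℤ-homo-+ (+ 1) (+ n))) ⟩
        ι (1ℚ ℚ.+ fromℕ n) * x         ≈⟨ *-congʳ (+-homo 1ℚ (fromℕ n)) ⟩
        (ι 1ℚ + ι (fromℕ n)) * x       ≈⟨ distribʳ _ _ _ ⟩
        ι 1ℚ * x + ι (fromℕ n) * x     ≈⟨ +-cong (trans (*-congʳ 1#-homo) (*-identityˡ x)) (ι-fromℕ n x) ⟩
        suc n × x                      ∎

      interchange : ∀ x y z w → (x * y) * (z * w) ≈ (x * z) * (y * w)
      interchange = CommutativeSemigroupProperties.interchange *-commutativeSemigroup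

      term : ∀ n k → k ℕ.≤ n →
        scale u exp k * scale v exp (n ∸ k) ≈ ι (exp n) * ((n C k) × (u ^ k * v ^ (n ∸ k)))
      term n k k≤n = begin
        (ι (exp k) * u ^ k) * (ι (exp (n ∸ k)) * v ^ (n ∸ k))
          ≈⟨ interchange _ _ _ _ ⟩
        (ι (exp k) * ι (exp (n ∸ k))) * (u ^ k * v ^ (n ∸ k))
          ≈⟨ *-congʳ (*-homo _ _) ⟨
        ι (exp k ℚ.* exp (n ∸ k)) * (u ^ k * v ^ (n ∸ k))
          ≈⟨ *-congʳ (⟦⟧-cong (exp*exp k≤n)) ⟩
        ι (exp n ℚ.* fromℕ (n C k)) * (u ^ k * v ^ (n ∸ k))
          ≈⟨ *-congʳ (*-homo _ _) ⟩
        ι (exp n) * ι (fromℕ (n C k)) * (u ^ k * v ^ (n ∸ k))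
          ≈⟨ *-assoc _ _ _ ⟩
        ι (exp n) * (ι (fromℕ (n C k)) * (u ^ k * v ^ (n ∸ k)))
          ≈⟨ *-congˡ (ι-fromℕ (n C k) _) ⟩
        ι (exp n) * ((n C k) × (u ^ k * v ^ (n ∸ k))) ∎

      -- In degree n this is the binomial theorem for u + v, divided by n!.
      exp-law : scale u exp A⟦t⟧.⋆ scale v exp A⟦t⟧.≋ scale (u + v) exp
      exp-law n = begin
        (scale u exp A⟦t⟧.⋆ scale v exp) n
          ≈⟨ ∑.sum-cong-≋ {suc n} (λ k → term n (toℕ k) (toℕ≤pred[n] k)) ⟩
        ∑.sum (λ k → ι (exp n) * Binomial.binomialTerm A u v n k)
          ≈⟨ ∑.*-distribˡ-sum (ι (exp n)) (Binomial.binomialTerm A u v n) ⟨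
        ι (exp n) * Binomial.binomialExpansion A u v n
          ≈⟨ *-congˡ (Binomial.theorem A n u v) ⟨
        scale (u + v) exp n ∎

  open Law public using (exp-law)

  module _ where
    open CommutativeSemiring A⟦t⟧.powerSeries
      using ()
      renaming (_+_ to _⊞_; _*_ to _⋆_; _≈_ to _≋_; 1# to 𝟙; +-cong to ⊞-cong; *-cong to ⋆-cong;
        setoid to ≋-setoid; sym to ≋-sym; refl to ≋-refl)
    open SetoidReasoning ≋-setoid

    private
      ε : Carrier → A⟦t⟧.PS
      ε c = scale c expm1

      γ : Carrier → A⟦t⟧.PS
      γ c = scale c (inverse exp+1)

      exp-ε : ∀ c → scale c exp ≋ 𝟙 ⊞ ε c
      exp-ε c = begin
        scale c exp                       ≈⟨ scale-cong c exp≋1+expm1 ⟩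
        scale c (ℚ⟦x⟧.𝟙 ℚ⟦x⟧.⊞ expm1)     ≈⟨ scale-⊞ c ℚ⟦x⟧.𝟙 expm1 ⟩
        scale c ℚ⟦x⟧.𝟙 ⊞ ε c              ≈⟨ ⊞-cong (scale-𝟙 c) (≋-refl {ε c}) ⟩
        𝟙 ⊞ ε c                           ∎

      ε-γ : ∀ c → (𝟙 ⊞ 𝟙 ⊞ ε c) ⋆ γ c ≋ 𝟙
      ε-γ c = begin
        (𝟙 ⊞ 𝟙 ⊞ ε c) ⋆ γ c                                       ≈⟨ ⋆-cong {y = scale c exp+1} {u = γ c} (≋-sym 2+ε) ≋-refl ⟩
        scale c exp+1 ⋆ γ c                                       ≈⟨ scale-⋆ c exp+1 (inverse exp+1) ⟨
        scale c (exp+1 ⊛ inverse exp+1)                           ≈⟨ scale-cong c exp+1-inverse ⟩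
        scale c ℚ⟦x⟧.𝟙                                            ≈⟨ scale-𝟙 c ⟩
        𝟙                                                         ∎
        where
        2+ε : scale c exp+1 ≋ 𝟙 ⊞ 𝟙 ⊞ ε c
        2+ε = begin
          scale c exp+1                                   ≈⟨ scale-cong c exp+1≋2+expm1 ⟩
          scale c (ℚ⟦x⟧.𝟙 ℚ⟦x⟧.⊞ ℚ⟦x⟧.𝟙 ℚ⟦x⟧.⊞ expm1)     ≈⟨ scale-⊞ c (ℚ⟦x⟧.𝟙 ℚ⟦x⟧.⊞ ℚ⟦x⟧.𝟙) expm1 ⟩
          scale c (ℚ⟦x⟧.𝟙 ℚ⟦x⟧.⊞ ℚ⟦x⟧.𝟙) ⊞ ε c            ≈⟨ ⊞-cong (scale-⊞ c ℚ⟦x⟧.𝟙 ℚ⟦x⟧.𝟙) (≋-refl {ε c}) ⟩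
          scale c ℚ⟦x⟧.𝟙 ⊞ scale c ℚ⟦x⟧.𝟙 ⊞ ε c           ≈⟨ ⊞-cong (⊞-cong (scale-𝟙 c) (scale-𝟙 c)) (≋-refl {ε c}) ⟩
          𝟙 ⊞ 𝟙 ⊞ ε c                                     ∎

      ε₀ : ∀ c → ε c 0 ≈ 0#
      ε₀ c = trans (*-congʳ 0#-homo) (zeroˡ _)

      -- The exponential law gives this identity with 𝟙 added to both sides, and a semiring does not
      -- allow that 𝟙 to be cancelled. Hence the split by degree: in degree zero everything
      -- vanishes, and in positive degree the coefficient of 𝟙 is zero.
      ε-law : ε (u + v) ≋ ε u ⊞ ε v ⊞ ε u ⋆ ε v
      ε-law zero    = trans (ε₀ (u + v)) (sym (trans
        (+-cong (+-cong (ε₀ u) (ε₀ v)) (+-congʳ (*-cong (ε₀ u) (ε₀ v))))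
        (trans (+-cong (+-identityʳ 0#) (trans (+-identityʳ _) (zeroˡ 0#))) (+-identityʳ 0#))))
      ε-law (suc n) = trans (trans (sym (+-identityˡ _)) (1+ε-law (suc n))) (+-congʳ (+-congʳ (+-identityˡ _)))
        where
        1+ε-law : 𝟙 ⊞ ε (u + v) ≋ 𝟙 ⊞ ε u ⊞ ε v ⊞ ε u ⋆ ε v
        1+ε-law = begin
          𝟙 ⊞ ε (u + v)                 ≈⟨ exp-ε (u + v) ⟨
          scale (u + v) exp             ≈⟨ exp-law ⟨
          scale u exp ⋆ scale v exp     ≈⟨ ⋆-cong (exp-ε u) (exp-ε v) ⟩
          (𝟙 ⊞ ε u) ⋆ (𝟙 ⊞ ε v)
            ≈⟨ solve 2 (λ x y → (con 1 :+ x) :* (con 1 :+ y) := con 1 :+ x :+ y :+ x :* y) (λ _ → refl) (ε u) (ε v) ⟩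
          𝟙 ⊞ ε u ⊞ ε v ⊞ ε u ⋆ ε v     ∎
          where open SemiringSolver A⟦t⟧.powerSeries

    tanh½-law : scale u tanh½ ⊞ scale v tanh½ ≋
      scale (u + v) tanh½ ⊞ (scale u tanh½ ⋆ scale v tanh½) ⋆ scale (u + v) tanh½
    tanh½-law = begin
      τ u ⊞ τ v                           ≈⟨ ⊞-cong (τ≋ u) (τ≋ v) ⟩
      ε u ⋆ γ u ⊞ ε v ⋆ γ v
        ≈⟨ TanhAlgebra.tanh-addition A⟦t⟧.powerSeries (ε u) (ε v) (ε (u + v)) (γ u) (γ v) (γ (u + v))
             ε-law (ε-γ u) (ε-γ v) (ε-γ (u + v)) ⟩
      ε (u + v) ⋆ γ (u + v) ⊞ ((ε u ⋆ γ u) ⋆ (ε v ⋆ γ v)) ⋆ (ε (u + v) ⋆ γ (u + v))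
        ≈⟨ ⊞-cong (τ≋ (u + v)) (⋆-cong (⋆-cong (τ≋ u) (τ≋ v)) (τ≋ (u + v))) ⟨
      τ (u + v) ⊞ (τ u ⋆ τ v) ⋆ τ (u + v) ∎
      where
      τ : Carrier → A⟦t⟧.PS
      τ c = scale c tanh½
      τ≋ : ∀ c → τ c ≋ ε c ⋆ γ c
      τ≋ c = scale-⋆ c expm1 (inverse exp+1)

open import Data.Rational using (_+_; _*_; -_; _-_)
open import Relation.Binary.PropositionalEquality using (_≡_; refl; sym; trans; cong; cong₂; subst; module ≡-Reasoning)

open ℚ⟦x⟧
open SemiringSum (CommutativeSemiring.semiring ℚ-semiring) using (*-distribˡ-sum; *-distribʳ-sum; ∑-distrib-+; sum-replicate-zero)

-- The addition formula at y = -x gives T(-x) + T(x) = 0.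
tanh½-even : ∀ m → tanh½ (2 ℕ.* m) ≡ 0ℚ
tanh½-even m = begin
  t                           ≡⟨ ℚ.*-identityˡ t ⟨
  1ℚ * t                      ≡⟨ ℚ.*-distribʳ-+ t ½ ½ ⟩
  ½ * t + ½ * t               ≡⟨ ℚ.*-distribˡ-+ ½ t t ⟨
  ½ * (t + t)                 ≡⟨ cong (½ *_) t+t≡0 ⟩
  0ℚ                          ∎
  where
  open ≡-Reasoning
  open Exponentiation ℚ-semiring using (_^_; ^-assocʳ)
  open AdditionLaw ℚ-semiring id
    (Identity.isSemiringHomomorphism (CommutativeSemiring.rawSemiring ℚ-semiring) refl) (- 1ℚ) 1ℚ
  n = 2 ℕ.* m
  t = tanh½ n

  1^ : ∀ k → 1ℚ ^ k ≡ 1ℚ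
  1^ zero    = refl
  1^ (suc k) = trans (ℚ.*-identityˡ _) (1^ k)

  scale-0 : scale 0ℚ tanh½ ≋ 𝟘
  scale-0 zero    = refl
  scale-0 (suc k) = trans (cong (tanh½ (suc k) *_) (ℚ.*-zeroˡ (0ℚ ^ k))) (ℚ.*-zeroʳ (tanh½ (suc k)))

  t+t≡0 : t + t ≡ 0ℚ
  t+t≡0 = begin
    t + t
      ≡⟨ cong₂ _+_ (ℚ.*-identityʳ t) (ℚ.*-identityʳ t) ⟨
    t * 1ℚ + t * 1ℚ
      ≡⟨ cong₂ (λ x y → t * x + t * y) (trans (sym (^-assocʳ (- 1ℚ) 2 m)) (1^ m)) (1^ n) ⟨
    t * (- 1ℚ) ^ n + t * 1ℚ ^ n
      -- Here u + v is - 1ℚ + 1ℚ, which computes to 0ℚ.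
      ≡⟨ tanh½-law n ⟩
    scale 0ℚ tanh½ n + ((scale (- 1ℚ) tanh½ ⋆ scale 1ℚ tanh½) ⋆ scale 0ℚ tanh½) n
      ≡⟨ cong₂ _+_ (scale-0 n) (⋆-comm (scale (- 1ℚ) tanh½ ⋆ scale 1ℚ tanh½) (scale 0ℚ tanh½) n) ⟩
    0ℚ + (scale 0ℚ tanh½ ⋆ (scale (- 1ℚ) tanh½ ⋆ scale 1ℚ tanh½)) n
      ≡⟨ ℚ.+-identityˡ _ ⟩
    (scale 0ℚ tanh½ ⋆ (scale (- 1ℚ) tanh½ ⋆ scale 1ℚ tanh½)) n
      ≡⟨ ⋆-cong {g = scale (- 1ℚ) tanh½ ⋆ scale 1ℚ tanh½} scale-0 (λ _ → refl) n ⟩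
    (𝟘 ⋆ (scale (- 1ℚ) tanh½ ⋆ scale 1ℚ tanh½)) n
      ≡⟨ 𝟘-⋆ (scale (- 1ℚ) tanh½ ⋆ scale 1ℚ tanh½) n ⟩
    0ℚ ∎

-- Evaluation of binary forms by Pascal arrays

module ℚ⟦x⟧ₛ where
  open CommutativeSemiring powerSeries public
  open Exponentiation powerSeries public using (_^_)
  open SemiringSum semiring public using (sum; *-distribʳ-sum)

const-isHomomorphism : SemiringMorphisms.IsSemiringHomomorphism
  (CommutativeSemiring.rawSemiring ℚ-semiring) (CommutativeSemiring.rawSemiring powerSeries) const
const-isHomomorphism = record
  { isNearSemiringHomomorphism = record
    { +-isMonoidHomomorphism = record
      { isMagmaHomomorphism = record
        { isRelHomomorphism = record { cong = λ { refl _ → refl } }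
        ; homo = λ { a b zero → refl ; a b (suc n) → refl }
        }
      ; ε-homo = λ { zero → refl ; (suc n) → refl }
      }
    ; *-homo = λ a b n → trans (const-* a b n) (sym (const-⋆ a (const b) n))
    }
  ; 1#-homo = λ _ → refl
  }
  where
  const-* : ∀ a b → const (a * b) ≋ a • const b
  const-* a b zero    = refl
  const-* a b (suc n) = sym (ℚ.*-zeroʳ a)

-- The functional xᵏ ↦ φ k (M - k) on polynomials of degree at most M.
Λ : (ℕ → ℕ → ℚ) → ℕ → PS → ℚ
Λ φ M g = ∑[ k ≤ M ] (g (toℕ k) * φ (toℕ k) (M ∸ toℕ k))

module _ (φ : ℕ → ℕ → ℚ) (M : ℕ) where

  Λ-cong : ∀ {f g} → f ≋ g → Λ φ M f ≡ Λ φ M g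
  Λ-cong f≋g = sum-cong-≗ {suc M} (λ k → cong (_* φ (toℕ k) (M ∸ toℕ k)) (f≋g (toℕ k)))

  Λ-⊞ : ∀ f g → Λ φ M (f ⊞ g) ≡ Λ φ M f + Λ φ M g
  Λ-⊞ f g = trans
    (sum-cong-≗ {suc M} (λ k → ℚ.*-distribʳ-+ (φ (toℕ k) (M ∸ toℕ k)) (f (toℕ k)) (g (toℕ k))))
    (∑-distrib-+ {suc M} (λ k → f (toℕ k) * φ (toℕ k) (M ∸ toℕ k)) (λ k → g (toℕ k) * φ (toℕ k) (M ∸ toℕ k)))

  Λ-• : ∀ a f → Λ φ M (a • f) ≡ a * Λ φ M f
  Λ-• a f = trans
    (sum-cong-≗ {suc M} (λ k → ℚ.*-assoc a (f (toℕ k)) (φ (toℕ k) (M ∸ toℕ k))))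
    (sym (*-distribˡ-sum {suc M} a (λ k → f (toℕ k) * φ (toℕ k) (M ∸ toℕ k))))

  Λ-𝟘 : Λ φ M 𝟘 ≡ 0ℚ
  Λ-𝟘 = trans (Λ-cong (λ _ → sym (ℚ.*-zeroˡ 0ℚ))) (trans (Λ-• 0ℚ 𝟘) (ℚ.*-zeroˡ (Λ φ M 𝟘)))

  Λ-sum : ∀ {n} (f : Fin n → PS) → Λ φ M (ℚ⟦x⟧ₛ.sum f) ≡ sum (λ i → Λ φ M (f i))
  Λ-sum {zero}  f = Λ-𝟘
  Λ-sum {suc n} f = trans (Λ-⊞ (f zero) (ℚ⟦x⟧ₛ.sum (f ∘ suc))) (cong (λ c → Λ φ M (f zero) + c) (Λ-sum (f ∘ suc)))

-- The degree rises together with the exponent, so the second index M - k stays the same and only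
-- the first index of φ moves.
Λ-shift : ∀ φ M g → Λ φ (suc M) (shift g) ≡ Λ (φ ∘ suc) M g
Λ-shift φ M g = trans (cong (_+ Λ (φ ∘ suc) M g) (ℚ.*-zeroˡ (φ 0 (suc M)))) (ℚ.+-identityˡ (Λ (φ ∘ suc) M g))

Pascal : (ℕ → ℕ → ℕ → ℚ) → Set
Pascal F = ∀ p q w → F p q (suc w) ≡ F (suc p) q w + F p (suc q) w

-- Since y is set to 1, a factor y to the q leaves no trace in the series; it is encoded by taking
-- `Λ` in degree w + q. Multiplication by x + 1 is a shift plus the identity, and these two parts
-- raise p and q respectively, as in `Pascal`.
Λ-[x+1]^ : ∀ F → Pascal F → ∀ w q → Λ (λ i j → F i j 0) (w ℕ.+ q) ((𝐱 ⊞ 𝟙) ℚ⟦x⟧ₛ.^ w) ≡ F 0 q w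
Λ-[x+1]^ F pascal zero q = begin
  1ℚ * F 0 q 0 + rest         ≡⟨ cong₂ _+_ (ℚ.*-identityˡ (F 0 q 0)) (rest≡0 q) ⟩
  F 0 q 0 + 0ℚ                ≡⟨ ℚ.+-identityʳ (F 0 q 0) ⟩
  F 0 q 0                     ∎
  where
  open ≡-Reasoning
  rest = ∑[ k < q ] (0ℚ * F (suc (toℕ k)) (q ∸ suc (toℕ k)) 0)
  rest≡0 : ∀ q → ∑[ k < q ] (0ℚ * F (suc (toℕ k)) (q ∸ suc (toℕ k)) 0) ≡ 0ℚ
  rest≡0 q = trans
    (sum-cong-≗ {q} (λ k → ℚ.*-zeroˡ (F (suc (toℕ k)) (q ∸ suc (toℕ k)) 0)))
    (sum-replicate-zero q)
Λ-[x+1]^ F pascal (suc w) q = begin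
  Λ φ (suc w ℕ.+ q) ((𝐱 ⊞ 𝟙) ⋆ P)
    ≡⟨ Λ-cong φ (suc w ℕ.+ q) expand ⟩
  Λ φ (suc (w ℕ.+ q)) (shift P ⊞ P)
    ≡⟨ Λ-⊞ φ (suc w ℕ.+ q) (shift P) P ⟩
  Λ φ (suc (w ℕ.+ q)) (shift P) + Λ φ (suc (w ℕ.+ q)) P
    ≡⟨ cong₂ _+_ (Λ-shift φ (w ℕ.+ q) P) (cong (λ M → Λ φ M P) (sym (ℕ.+-suc w q))) ⟩
  Λ (φ ∘ suc) (w ℕ.+ q) P + Λ φ (w ℕ.+ suc q) P
    ≡⟨ cong₂ _+_ (Λ-[x+1]^ (F ∘ suc) (pascal ∘ suc) w q) (Λ-[x+1]^ F pascal w (suc q)) ⟩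
  F 1 q w + F 0 (suc q) w
    ≡⟨ pascal 0 q w ⟨
  F 0 q (suc w) ∎
  where
  open ≡-Reasoning
  φ : ℕ → ℕ → ℚ
  φ i j = F i j 0
  P = (𝐱 ⊞ 𝟙) ℚ⟦x⟧ₛ.^ w
  expand : (𝐱 ⊞ 𝟙) ⋆ P ≋ shift P ⊞ P
  expand n = trans (⋆-distribʳ P 𝐱 𝟙 n) (cong₂ _+_ (𝐱-⋆ P n) (⋆-identityˡ P n))

-- Each factor x can be traded for replacing F by `F ∘ suc`, which is again a Pascal array, until p
-- = 0.
Λ-x^[x+1]^ : ∀ F → Pascal F → ∀ p q w →
  Λ (λ i j → F i j 0) (p ℕ.+ (w ℕ.+ q)) (𝐱 ℚ⟦x⟧ₛ.^ p ⋆ (𝐱 ⊞ 𝟙) ℚ⟦x⟧ₛ.^ w) ≡ F p q w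
Λ-x^[x+1]^ F pascal zero q w = trans
  (Λ-cong (λ i j → F i j 0) (w ℕ.+ q) (⋆-identityˡ ((𝐱 ⊞ 𝟙) ℚ⟦x⟧ₛ.^ w)))
  (Λ-[x+1]^ F pascal w q)
Λ-x^[x+1]^ F pascal (suc p) q w = begin
  Λ φ (suc M) ((𝐱 ⋆ Q) ⋆ P)     ≡⟨ Λ-cong φ (suc M) (λ n → trans (⋆-assoc 𝐱 Q P n) (𝐱-⋆ (Q ⋆ P) n)) ⟩
  Λ φ (suc M) (shift (Q ⋆ P))   ≡⟨ Λ-shift φ M (Q ⋆ P) ⟩
  Λ (φ ∘ suc) M (Q ⋆ P)         ≡⟨ Λ-x^[x+1]^ (F ∘ suc) (pascal ∘ suc) p q w ⟩
  F (suc p) q w                 ∎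
  where
  open ≡-Reasoning
  φ : ℕ → ℕ → ℚ
  φ i j = F i j 0
  M = p ℕ.+ (w ℕ.+ q)
  P = (𝐱 ⊞ 𝟙) ℚ⟦x⟧ₛ.^ w
  Q = 𝐱 ℚ⟦x⟧ₛ.^ p

𝟙^ : ∀ n → 𝟙 ℚ⟦x⟧ₛ.^ n ≋ 𝟙
𝟙^ zero    k = refl
𝟙^ (suc n) k = trans (⋆-identityˡ (𝟙 ℚ⟦x⟧ₛ.^ n) k) (𝟙^ n k)

-- The addition formula in ℚ[[x]][[t]], with T(xt) + T(t) on the left, under Λ in degree M.
module TanhPascal (F : ℕ → ℕ → ℕ → ℚ) (pascal : Pascal F) where
  open AdditionLaw powerSeries const const-isHomomorphism 𝐱 𝟙

  private
    φ : ℕ → ℕ → ℚ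
    φ i j = F i j 0

    𝐲 : PS
    𝐲 = 𝐱 ⊞ 𝟙

    T : Series
    T = tanh½

    module ⟦t⟧ = PowerSeries powerSeries

  Λ-term : ∀ p q w {M} → M ≡ p ℕ.+ (w ℕ.+ q) →
    Λ φ M ((scale 𝐱 T p ⋆ scale 𝟙 T q) ⋆ scale 𝐲 T w) ≡ T p * T q * T w * F p q w
  Λ-term p q w refl = begin
    Λ φ M ((scale 𝐱 T p ⋆ scale 𝟙 T q) ⋆ scale 𝐲 T w)
      ≡⟨ Λ-cong φ M simplify ⟩
    Λ φ M ((T p * T q * T w) • (𝐱 ℚ⟦x⟧ₛ.^ p ⋆ 𝐲 ℚ⟦x⟧ₛ.^ w))
      ≡⟨ Λ-• φ M (T p * T q * T w) (𝐱 ℚ⟦x⟧ₛ.^ p ⋆ 𝐲 ℚ⟦x⟧ₛ.^ w) ⟩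
    T p * T q * T w * Λ φ M (𝐱 ℚ⟦x⟧ₛ.^ p ⋆ 𝐲 ℚ⟦x⟧ₛ.^ w)
      ≡⟨ cong (T p * T q * T w *_) (Λ-x^[x+1]^ F pascal p q w) ⟩
    T p * T q * T w * F p q w ∎
    where
    open ≡-Reasoning
    M = p ℕ.+ (w ℕ.+ q)
    simplify : (scale 𝐱 T p ⋆ scale 𝟙 T q) ⋆ scale 𝐲 T w ≋ (T p * T q * T w) • (𝐱 ℚ⟦x⟧ₛ.^ p ⋆ 𝐲 ℚ⟦x⟧ₛ.^ w)
    simplify = R.begin
      (const (T p) ⋆ X ⋆ (const (T q) ⋆ 𝟙 ℚ⟦x⟧ₛ.^ q)) ⋆ (const (T w) ⋆ Y)
        R.≈⟨ ℚ⟦x⟧ₛ.*-congʳ {const (T w) ⋆ Y} (ℚ⟦x⟧ₛ.*-congˡ {const (T p) ⋆ X} (ℚ⟦x⟧ₛ.*-congˡ {const (T q)} (𝟙^ q))) ⟩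
      (const (T p) ⋆ X ⋆ (const (T q) ⋆ 𝟙)) ⋆ (const (T w) ⋆ Y)
        R.≈⟨ rearrange (const (T p)) X (const (T q)) (const (T w)) Y ⟩
      (const (T p) ⋆ const (T q)) ⋆ const (T w) ⋆ (X ⋆ Y)
        R.≈⟨ ℚ⟦x⟧ₛ.*-congʳ {X ⋆ Y} (ℚ⟦x⟧ₛ.*-congʳ {const (T w)} (*-homo (T p) (T q))) ⟨
      const (T p * T q) ⋆ const (T w) ⋆ (X ⋆ Y)
        R.≈⟨ ℚ⟦x⟧ₛ.*-congʳ {X ⋆ Y} (*-homo (T p * T q) (T w)) ⟨
      const (T p * T q * T w) ⋆ (X ⋆ Y)
        R.≈⟨ const-⋆ (T p * T q * T w) (X ⋆ Y) ⟩
      (T p * T q * T w) • (X ⋆ Y) R.∎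
      where
      module R = SetoidReasoning ℚ⟦x⟧ₛ.setoid
      open SemiringMorphisms.IsSemiringHomomorphism const-isHomomorphism using (*-homo)
      X = 𝐱 ℚ⟦x⟧ₛ.^ p
      Y = 𝐲 ℚ⟦x⟧ₛ.^ w
      open SemiringSolver powerSeries
      rearrange : ∀ a x b c y → (a ⋆ x ⋆ (b ⋆ 𝟙)) ⋆ (c ⋆ y) ≋ (a ⋆ b) ⋆ c ⋆ (x ⋆ y)
      rearrange = solve 5 (λ a x b c y → (a :* x :* (b :* con 1)) :* (c :* y) := (a :* b) :* c :* (x :* y)) (λ _ → refl)

  Λ-scale : ∀ c n {x M} → Λ φ M (c ℚ⟦x⟧ₛ.^ n) ≡ x → Λ φ M (scale c T n) ≡ T n * x
  Λ-scale c n {M = M} eq = trans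
    (Λ-cong φ M (const-⋆ (T n) (c ℚ⟦x⟧ₛ.^ n)))
    (trans (Λ-• φ M (T n) (c ℚ⟦x⟧ₛ.^ n)) (cong (T n *_) eq))

  -- The triple product is bracketed as (T(xt) T(t)) T((x + 1)t), so the outer index W is the joint
  -- degree p + q of the first two factors and w = M - W.
  tanh½-pascal : ∀ M → T M * F M 0 0 + T M * F 0 M 0 ≡
    T M * F 0 0 M + ∑[ W ≤ M ] (∑[ p ≤ toℕ W ]
      (T (toℕ p) * T (toℕ W ∸ toℕ p) * T (M ∸ toℕ W) * F (toℕ p) (toℕ W ∸ toℕ p) (M ∸ toℕ W)))
  tanh½-pascal M = begin
    T M * F M 0 0 + T M * F 0 M 0
      ≡⟨ cong₂ _+_ (Λ-scale 𝐱 M {F M 0 0} {M} Λ-𝐱^) (Λ-scale 𝟙 M {F 0 M 0} {M} Λ-𝟙^) ⟨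
    Λ φ M (scale 𝐱 T M) + Λ φ M (scale 𝟙 T M)
      ≡⟨ Λ-⊞ φ M (scale 𝐱 T M) (scale 𝟙 T M) ⟨
    Λ φ M (scale 𝐱 T M ⊞ scale 𝟙 T M)
      ≡⟨ Λ-cong φ M (tanh½-law M) ⟩
    Λ φ M (scale 𝐲 T M ⊞ ((scale 𝐱 T ⟦t⟧.⋆ scale 𝟙 T) ⟦t⟧.⋆ scale 𝐲 T) M)
      ≡⟨ Λ-⊞ φ M (scale 𝐲 T M) (((scale 𝐱 T ⟦t⟧.⋆ scale 𝟙 T) ⟦t⟧.⋆ scale 𝐲 T) M) ⟩
    Λ φ M (scale 𝐲 T M) + Λ φ M (((scale 𝐱 T ⟦t⟧.⋆ scale 𝟙 T) ⟦t⟧.⋆ scale 𝐲 T) M)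
      ≡⟨ cong₂ _+_ (Λ-scale 𝐲 M {F 0 0 M} {M} Λ-𝐲^) Λ-product ⟩
    T M * F 0 0 M + ∑[ W ≤ M ] (∑[ p ≤ toℕ W ] term W p) ∎
    where
    open ≡-Reasoning
    term : (W : Fin (suc M)) → Fin (suc (toℕ W)) → ℚ
    term W p = T (toℕ p) * T (toℕ W ∸ toℕ p) * T (M ∸ toℕ W) * F (toℕ p) (toℕ W ∸ toℕ p) (M ∸ toℕ W)

    Λ-𝐱^ : Λ φ M (𝐱 ℚ⟦x⟧ₛ.^ M) ≡ F M 0 0
    Λ-𝐱^ = trans
      (Λ-cong φ M (λ n → sym (ℚ⟦x⟧ₛ.*-identityʳ (𝐱 ℚ⟦x⟧ₛ.^ M) n)))
      (trans (cong (λ N → Λ φ N (𝐱 ℚ⟦x⟧ₛ.^ M ⋆ 𝟙)) (sym (ℕ.+-identityʳ M))) (Λ-x^[x+1]^ F pascal M 0 0))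

    Λ-𝟙^ : Λ φ M (𝟙 ℚ⟦x⟧ₛ.^ M) ≡ F 0 M 0
    Λ-𝟙^ = trans (Λ-cong φ M (𝟙^ M)) (Λ-[x+1]^ F pascal 0 M)

    Λ-𝐲^ : Λ φ M (𝐲 ℚ⟦x⟧ₛ.^ M) ≡ F 0 0 M
    Λ-𝐲^ = trans (cong (λ N → Λ φ N (𝐲 ℚ⟦x⟧ₛ.^ M)) (sym (ℕ.+-identityʳ M))) (Λ-[x+1]^ F pascal M 0)

    split : ∀ {p W} → p ℕ.≤ W → W ℕ.≤ M → M ≡ p ℕ.+ ((M ∸ W) ℕ.+ (W ∸ p))
    split {p} {W} p≤W W≤M = begin
      M                               ≡⟨ ℕ.m+[n∸m]≡n W≤M ⟨
      W ℕ.+ (M ∸ W)                   ≡⟨ cong (ℕ._+ (M ∸ W)) (ℕ.m+[n∸m]≡n p≤W) ⟨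
      p ℕ.+ (W ∸ p) ℕ.+ (M ∸ W)       ≡⟨ ℕ.+-assoc p (W ∸ p) (M ∸ W) ⟩
      p ℕ.+ ((W ∸ p) ℕ.+ (M ∸ W))     ≡⟨ cong (p ℕ.+_) (ℕ.+-comm (W ∸ p) (M ∸ W)) ⟩
      p ℕ.+ ((M ∸ W) ℕ.+ (W ∸ p))     ∎

    Λ-inner : (W : Fin (suc M)) →
      Λ φ M ((scale 𝐱 T ⟦t⟧.⋆ scale 𝟙 T) (toℕ W) ⋆ scale 𝐲 T (M ∸ toℕ W)) ≡ ∑[ p ≤ toℕ W ] term W p
    Λ-inner W = begin
      Λ φ M (ℚ⟦x⟧ₛ.sum X ⋆ Y)
        ≡⟨ Λ-cong φ M (ℚ⟦x⟧ₛ.*-distribʳ-sum Y X) ⟩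
      Λ φ M (ℚ⟦x⟧ₛ.sum (λ p → X p ⋆ Y))
        ≡⟨ Λ-sum φ M (λ p → X p ⋆ Y) ⟩
      ∑[ p ≤ toℕ W ] Λ φ M (X p ⋆ Y)
        ≡⟨ sum-cong-≗ {suc (toℕ W)} (λ p → Λ-term (toℕ p) (toℕ W ∸ toℕ p) (M ∸ toℕ W)
             (split (toℕ≤pred[n] p) (toℕ≤pred[n] W))) ⟩
      ∑[ p ≤ toℕ W ] term W p ∎
      where
      Y = scale 𝐲 T (M ∸ toℕ W)
      X : Fin (suc (toℕ W)) → PS
      X p = scale 𝐱 T (toℕ p) ⋆ scale 𝟙 T (toℕ W ∸ toℕ p)

    Λ-product : Λ φ M (((scale 𝐱 T ⟦t⟧.⋆ scale 𝟙 T) ⟦t⟧.⋆ scale 𝐲 T) M) ≡ ∑[ W ≤ M ] (∑[ p ≤ toℕ W ] term W p)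
    Λ-product = trans
      (Λ-sum φ M (λ (W : Fin (suc M)) → (scale 𝐱 T ⟦t⟧.⋆ scale 𝟙 T) (toℕ W) ⋆ scale 𝐲 T (M ∸ toℕ W)))
      (sum-cong-≗ {suc M} Λ-inner)

-- Coefficients of Euler polynomials

open ≡-Reasoning

rising : ℤ → ℕ → ℤ
rising a zero    = 1ℤ
rising a (suc n) = a ℤ.* rising (ℤ.suc a) n

rising-last : ∀ a n → rising a (suc n) ≡ rising a n ℤ.* (a ℤ.+ + n)
rising-last a zero    = trans (ℤ.*-comm a 1ℤ) (cong (1ℤ ℤ.*_) (sym (ℤ.+-identityʳ a)))
rising-last a (suc n) = begin
  a ℤ.* rising (ℤ.suc a) (suc n)                         ≡⟨ cong (a ℤ.*_) (rising-last (ℤ.suc a) n) ⟩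
  a ℤ.* (rising (ℤ.suc a) n ℤ.* (ℤ.suc a ℤ.+ + n))       ≡⟨ regroup a (rising (ℤ.suc a) n) (+ n) ⟩
  a ℤ.* rising (ℤ.suc a) n ℤ.* (a ℤ.+ + suc n)           ∎
  where
  regroup : ∀ a b c → a ℤ.* (b ℤ.* (1ℤ ℤ.+ a ℤ.+ c)) ≡ a ℤ.* b ℤ.* (a ℤ.+ (1ℤ ℤ.+ c))
  regroup = ℤ.solve-∀

rising-! : ∀ j d → + (j !) ℤ.* rising (+ suc j) d ≡ + ((j ℕ.+ d) !)
rising-! j zero    = trans (ℤ.*-identityʳ (+ (j !))) (cong (+_ ∘ _!) (sym (ℕ.+-identityʳ j)))
rising-! j (suc d) = begin
  + (j !) ℤ.* (+ suc j ℤ.* R)       ≡⟨ ℤ.*-assoc (+ (j !)) (+ suc j) R ⟨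
  + (j !) ℤ.* + suc j ℤ.* R         ≡⟨ cong (ℤ._* R) (trans (ℤ.*-comm (+ (j !)) (+ suc j)) (sym (ℤ.pos-* (suc j) (j !)))) ⟩
  + (suc j !) ℤ.* R                 ≡⟨ rising-! (suc j) d ⟩
  + ((suc j ℕ.+ d) !)               ≡⟨ cong (+_ ∘ _!) (sym (ℕ.+-suc j d)) ⟩
  + ((j ℕ.+ suc d) !)               ∎
  where R = rising (+ suc (suc j)) d

rising-0 : ∀ {m n} → m ℕ.< n → rising (ℤ.- (+ m)) n ≡ 0ℤ
rising-0 {zero}  {suc n} _         = refl
rising-0 {suc m} {suc n} (s≤s m<n) = begin
  -[1+ m ] ℤ.* rising (1ℤ ℤ.+ -[1+ m ]) n   ≡⟨ cong (λ a → -[1+ m ] ℤ.* rising a n) (step m) ⟩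
  -[1+ m ] ℤ.* rising (ℤ.- (+ m)) n         ≡⟨ cong (-[1+ m ] ℤ.*_) (rising-0 m<n) ⟩
  -[1+ m ] ℤ.* 0ℤ                           ≡⟨ ℤ.*-zeroʳ -[1+ m ] ⟩
  0ℤ                                        ∎
  where
  step : ∀ m → 1ℤ ℤ.+ -[1+ m ] ≡ ℤ.- (+ m)
  step zero    = refl
  step (suc m) = refl

-- The factors 1 - c - n, ..., -c are the negatives of c + n - 1, ..., c, in the same order.
rising-reverse : ∀ c n → rising (1ℤ ℤ.- c ℤ.- + n) n ≡ -1ℤ ℤ.^ n ℤ.* rising c n
rising-reverse c zero    = refl
rising-reverse c (suc n) = begin
  (1ℤ ℤ.- c ℤ.- + suc n) ℤ.* rising (ℤ.suc (1ℤ ℤ.- c ℤ.- + suc n)) n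
    ≡⟨ cong₂ (λ x y → x ℤ.* rising y n) (first c (+ n)) (second c (+ n)) ⟩
  -1ℤ ℤ.* (c ℤ.+ + n) ℤ.* rising (1ℤ ℤ.- c ℤ.- + n) n
    ≡⟨ cong (-1ℤ ℤ.* (c ℤ.+ + n) ℤ.*_) (rising-reverse c n) ⟩
  -1ℤ ℤ.* (c ℤ.+ + n) ℤ.* (-1ℤ ℤ.^ n ℤ.* rising c n)
    ≡⟨ regroup (c ℤ.+ + n) (-1ℤ ℤ.^ n) (rising c n) ⟩
  -1ℤ ℤ.^ suc n ℤ.* (rising c n ℤ.* (c ℤ.+ + n))
    ≡⟨ cong (-1ℤ ℤ.^ suc n ℤ.*_) (rising-last c n) ⟨
  -1ℤ ℤ.^ suc n ℤ.* rising c (suc n) ∎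
  where
  first : ∀ c n → 1ℤ ℤ.- c ℤ.- (1ℤ ℤ.+ n) ≡ -1ℤ ℤ.* (c ℤ.+ n)
  first = ℤ.solve-∀
  second : ∀ c n → 1ℤ ℤ.+ (1ℤ ℤ.- c ℤ.- (1ℤ ℤ.+ n)) ≡ 1ℤ ℤ.- c ℤ.- n
  second = ℤ.solve-∀
  regroup : ∀ x s R → -1ℤ ℤ.* x ℤ.* (s ℤ.* R) ≡ -1ℤ ℤ.* s ℤ.* (R ℤ.* x)
  regroup = ℤ.solve-∀

rising-reverse-odd : ∀ c d → rising (1ℤ ℤ.- c ℤ.- + suc (2 ℕ.* d)) (suc (2 ℕ.* d)) ≡ ℤ.- rising c (suc (2 ℕ.* d))
rising-reverse-odd c d = begin
  rising (1ℤ ℤ.- c ℤ.- + suc (2 ℕ.* d)) (suc (2 ℕ.* d))  ≡⟨ rising-reverse c (suc (2 ℕ.* d)) ⟩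
  -1ℤ ℤ.* -1ℤ ℤ.^ (2 ℕ.* d) ℤ.* R                        ≡⟨ cong (λ s → -1ℤ ℤ.* s ℤ.* R) even-power ⟩
  -1ℤ ℤ.* R                                              ≡⟨ ℤ.-1*i≡-i R ⟩
  ℤ.- R                                                  ∎
  where
  R = rising c (suc (2 ℕ.* d))
  even-power : -1ℤ ℤ.^ (2 ℕ.* d) ≡ 1ℤ
  even-power = trans (sym (ℤ.^-*-assoc -1ℤ 2 d)) (ℤ.^-zeroˡ d)

-- This is T = 1 - 2/(eᵗ + 1), whose term 1 is invisible in positive degree.
tanh½-suc : ∀ m → tanh½ (suc m) ≡ - (2ℚ * inverse exp+1 (suc m))
tanh½-suc m = begin
  t                              ≡⟨ ℚ.+-identityˡ t ⟨
  0ℚ + t                         ≡⟨ cong (_+ t) (ℚ.+-inverseˡ (2ℚ * g)) ⟨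
  - (2ℚ * g) + 2ℚ * g + t        ≡⟨ ℚ.+-assoc (- (2ℚ * g)) (2ℚ * g) t ⟩
  - (2ℚ * g) + (2ℚ * g + t)      ≡⟨ cong (λ c → - (2ℚ * g) + c) 2g+t≡0 ⟩
  - (2ℚ * g) + 0ℚ                ≡⟨ ℚ.+-identityʳ (- (2ℚ * g)) ⟩
  - (2ℚ * g)                     ∎
  where
  G = inverse exp+1
  g = G (suc m)
  t = tanh½ (suc m)
  2g+t≡0 : 2ℚ * g + t ≡ 0ℚ
  2g+t≡0 = begin
    2ℚ * g + t                             ≡⟨ cong (_+ t) (ℚ.*-distribʳ-+ g 1ℚ 1ℚ) ⟩
    1ℚ * g + 1ℚ * g + t                    ≡⟨ cong₂ (λ x y → x + y + t) (const-⋆ 1ℚ G (suc m)) (const-⋆ 1ℚ G (suc m)) ⟨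
    (𝟙 ⋆ G) (suc m) + (𝟙 ⋆ G) (suc m) + t  ≡⟨ cong (_+ t) (⋆-distribʳ G 𝟙 𝟙 (suc m)) ⟨
    ((𝟙 ⊞ 𝟙) ⋆ G) (suc m) + t              ≡⟨ ⋆-distribʳ G (𝟙 ⊞ 𝟙) expm1 (suc m) ⟨
    ((𝟙 ⊞ 𝟙 ⊞ expm1) ⋆ G) (suc m)          ≡⟨ ⋆-cong {g = G} exp+1≋2+expm1 (λ _ → refl) (suc m) ⟨
    (exp+1 ⋆ G) (suc m)                    ≡⟨ exp+1-inverse (suc m) ⟩
    0ℚ                                     ∎

-- As a sequence in k the left factor is supported at k = j, so a single term of the convolution
-- survives.
pick-coefficient : ∀ c g j d → ((λ k → c k * (x^ k) j) ⋆ g) (j ℕ.+ d) ≡ c j * g d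
pick-coefficient c g zero    d = begin
  ((λ k → c k * (x^ k) 0) ⋆ g) d  ≡⟨ ⋆-cong {g = g} head (λ _ → refl) d ⟩
  (const (c 0) ⋆ g) d             ≡⟨ const-⋆ (c 0) g d ⟩
  c 0 * g d                       ∎
  where
  head : (λ k → c k * (x^ k) 0) ≋ const (c 0)
  head zero    = ℚ.*-identityʳ (c 0)
  head (suc k) = ℚ.*-zeroʳ (c (suc k))
pick-coefficient c g (suc j) d = begin
  c 0 * 0ℚ * g (suc j ℕ.+ d) + rest   ≡⟨ cong (λ z → z * g (suc j ℕ.+ d) + rest) (ℚ.*-zeroʳ (c 0)) ⟩
  0ℚ * g (suc j ℕ.+ d) + rest         ≡⟨ cong (_+ rest) (ℚ.*-zeroˡ (g (suc j ℕ.+ d))) ⟩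
  0ℚ + rest                           ≡⟨ ℚ.+-identityˡ rest ⟩
  rest                                ≡⟨ pick-coefficient (c ∘ suc) g j d ⟩
  c (suc j) * g d                     ∎
  where rest = ((λ k → c (suc k) * (x^ k) j) ⋆ g) (j ℕ.+ d)

x^-< : ∀ j d → (x^ (j ℕ.+ suc d)) j ≡ 0ℚ
x^-< zero    d = refl
x^-< (suc j) d = x^-< j d

-- With N = j + d + 1, applying T(d/dx) to the N-th power of x and reading off degree j leaves T in
-- degree d + 1 times N!/j!, and that quotient is the rising factorial (j + 1) ... N.
x^-E : ∀ j d → (x^ (j ℕ.+ suc d)) j - E (j ℕ.+ suc d) j ≡ tanh½ (suc d) * fromℤ (rising (+ suc j) (suc d))
x^-E j d = begin
  (x^ (j ℕ.+ suc d)) j - E (j ℕ.+ suc d) j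
    ≡⟨ cong₂ _-_ (x^-< j d) E≡ ⟩
  0ℚ - fromℕ (j !) * R * (2ℚ * exp j * g)
    ≡⟨ ℚ.+-identityˡ _ ⟩
  - (fromℕ (j !) * R * (2ℚ * exp j * g))
    ≡⟨ cong -_ (regroup (fromℕ (j !)) R 2ℚ (exp j) g) ⟩
  - (exp j * fromℕ (j !) * (2ℚ * g * R))
    ≡⟨ cong (λ c → - (c * (2ℚ * g * R))) (exp*! j) ⟩
  - (1ℚ * (2ℚ * g * R))
    ≡⟨ cong -_ (ℚ.*-identityˡ (2ℚ * g * R)) ⟩
  - (2ℚ * g * R)
    ≡⟨ ℚ.neg-distribˡ-* (2ℚ * g) R ⟩
  - (2ℚ * g) * R
    ≡⟨ cong (_* R) (tanh½-suc d) ⟨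
  tanh½ (suc d) * R ∎
  where
  g = inverse exp+1 (suc d)
  R = fromℤ (rising (+ suc j) (suc d))
  open SemiringSolver ℚ-semiring
  regroup : ∀ a r t e g → a * r * (t * e * g) ≡ e * a * (t * g * r)
  regroup = solve 5 (λ a r t e g → a :* r :* (t :* e :* g) := e :* a :* (t :* g :* r)) refl
  E≡ : E (j ℕ.+ suc d) j ≡ fromℕ (j !) * R * (2ℚ * exp j * g)
  E≡ = cong₂ _*_
    (trans (cong fromℤ (sym (rising-! j (suc d)))) (fromℤ-homo-* (+ (j !)) (rising (+ suc j) (suc d))))
    (trans
      (⋆-cong {g = inverse exp+1} (λ k → sym (ℚ.*-assoc 2ℚ (exp k) ((x^ k) j))) (λ _ → refl) (j ℕ.+ suc d))
      (pick-coefficient (λ k → 2ℚ * exp k) (inverse exp+1) j (suc d)))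

-- The generalised binomials

⌊⌋-true : ∀ {a} {A : Set a} (A? : Dec A) → A → ⌊ A? ⌋ ≡ true
⌊⌋-true A? a = trans (isYes≗does A?) (dec-true A? a)

⌊⌋-false : ∀ {a} {A : Set a} (A? : Dec A) → ¬ A → ⌊ A? ⌋ ≡ false
⌊⌋-false A? ¬a = trans (isYes≗does A?) (dec-false A? ¬a)

-- The value of  (i + d) choose i at (a - 2i).
value : ℤ → ℕ → ℚ
value a d = tanh½ (suc (2 ℕ.* d)) * fromℤ (rising a (suc (2 ℕ.* d)))

value-0 : ∀ {m} d → m ℕ.≤ 2 ℕ.* d → value (ℤ.- (+ m)) d ≡ 0ℚ
value-0 d m≤2d = trans
  (cong (λ z → tanh½ (suc (2 ℕ.* d)) * fromℤ z) (rising-0 (s≤s m≤2d)))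
  (ℚ.*-zeroʳ (tanh½ (suc (2 ℕ.* d))))

fromℤ-homo-neg : ∀ i → fromℤ (ℤ.- i) ≡ - fromℤ i
fromℤ-homo-neg (+ zero)  = refl
fromℤ-homo-neg (+ suc n) = refl
fromℤ-homo-neg -[1+ n ]  = sym (⁻¹-involutive ℚ.+-0-group (fromℤ (+ suc n)))

value-reverse : ∀ c d → - value c d ≡ value (1ℤ ℤ.- c ℤ.- + suc (2 ℕ.* d)) d
value-reverse c d = begin
  - (t * fromℤ R)    ≡⟨ ℚ.neg-distribʳ-* t (fromℤ R) ⟩
  t * - fromℤ R      ≡⟨ cong (t *_) (fromℤ-homo-neg R) ⟨
  t * fromℤ (ℤ.- R)  ≡⟨ cong (λ z → t * fromℤ z) (rising-reverse-odd c d) ⟨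
  value (1ℤ ℤ.- c ℤ.- + suc (2 ℕ.* d)) d ∎
  where
  t = tanh½ (suc (2 ℕ.* d))
  R = rising c (suc (2 ℕ.* d))

brack-value : ∀ j d → brack (+ (suc j ℕ.+ d)) (+ suc j) ≡ value (+ (2 ℕ.* suc j)) d
brack-value j d = begin
  brack (+ (suc j ℕ.+ d)) (+ suc j)
    ≡⟨ cong (λ b → if b then (x^ N) l - E N l else 0ℚ)
         (⌊⌋-true (+ suc j ℤ.≤? + (suc j ℕ.+ d)) (ℤ.+≤+ (ℕ.m≤m+n (suc j) d))) ⟩
  (x^ N) l - E N l
    ≡⟨ cong (λ N → (x^ N) l - E N l) (degree j d) ⟩
  (x^ (l ℕ.+ suc (2 ℕ.* d))) l - E (l ℕ.+ suc (2 ℕ.* d)) l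
    ≡⟨ x^-E l (2 ℕ.* d) ⟩
  value (+ (2 ℕ.* suc j)) d ∎
  where
  N = 2 ℕ.* (suc j ℕ.+ d)
  -- The normal form of 2 * suc j ∸ 1; its successor is 2 * suc j, the start of the rising
  -- factorial.
  l = j ℕ.+ suc (j ℕ.+ 0)
  degree : ∀ j d → 2 ℕ.* (1 ℕ.+ j ℕ.+ d) ≡ (j ℕ.+ (1 ℕ.+ (j ℕ.+ 0))) ℕ.+ (1 ℕ.+ 2 ℕ.* d)
  degree = ℕ.solve-∀

brace-value : ∀ j d → brace (+ (j ℕ.+ d)) (+ j) ≡ value (+ suc (2 ℕ.* j)) d
brace-value j d = begin
  brace (+ (j ℕ.+ d)) (+ j)
    ≡⟨ cong (λ b → if b then (x^ N) l - E N l else 0ℚ)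
         (⌊⌋-true (+ j ℤ.≤? + (j ℕ.+ d)) (ℤ.+≤+ (ℕ.m≤m+n j d))) ⟩
  (x^ N) l - E N l
    ≡⟨ cong (λ N → (x^ N) l - E N l) (degree j d) ⟩
  (x^ (l ℕ.+ suc (2 ℕ.* d))) l - E (l ℕ.+ suc (2 ℕ.* d)) l
    ≡⟨ x^-E l (2 ℕ.* d) ⟩
  value (+ suc (2 ℕ.* j)) d ∎
  where
  N = 2 ℕ.* (j ℕ.+ d) ℕ.+ 1
  l = 2 ℕ.* j
  degree : ∀ j d → 2 ℕ.* (j ℕ.+ d) ℕ.+ 1 ≡ 2 ℕ.* j ℕ.+ (1 ℕ.+ 2 ℕ.* d)
  degree = ℕ.solve-∀

evenCase : ℤ → ℤ → ℤ → ℚ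
evenCase h n i = if ⌊ 0ℤ ℤ.⊔ (ℤ.- h) ℤ.≤? n ⌋
  then brack (h ℤ.+ n) (h ℤ.+ i)
  else - brack (ℤ.- h ℤ.- i) (ℤ.- h ℤ.- n)

-- The definition halves r - 1 and r + 1 separately, so both halves are arguments; `byParity-value`
-- supplies h⁺ = h + 1.
oddCase : ℤ → ℤ → ℤ → ℤ → ℚ
oddCase h h⁺ n i = if ⌊ 0ℤ ℤ.⊔ (ℤ.- h) ℤ.≤? n ⌋
  then brace (h ℤ.+ n) (h ℤ.+ i)
  else - brace (ℤ.- h⁺ ℤ.- i) (ℤ.- h⁺ ℤ.- n)

-- Uniqueness of the quotient by 2: a remainder of 1 would make 1 an even number.
*2-cancel : ∀ {m} h q → m ℕ.< 2 → h ℤ.* + 2 ≡ + m ℤ.+ q ℤ.* + 2 → h ≡ q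
*2-cancel {0} h q _ eq = ℤ.*-cancelʳ-≡ h q (+ 2) (trans eq (ℤ.+-identityˡ (q ℤ.* + 2)))
*2-cancel {1} h q _ eq = contradiction odd (even≢1 ℤ.∣ h ℤ.- q ∣)
  where
  expand : ∀ h q → (h ℤ.- q) ℤ.* + 2 ≡ h ℤ.* + 2 ℤ.- q ℤ.* + 2
  expand = ℤ.solve-∀
  collapse : ∀ x → 1ℤ ℤ.+ x ℤ.- x ≡ 1ℤ
  collapse = ℤ.solve-∀
  odd : ℤ.∣ h ℤ.- q ∣ ℕ.* 2 ≡ 1
  odd = begin
    ℤ.∣ h ℤ.- q ∣ ℕ.* 2                 ≡⟨ ℤ.abs-* (h ℤ.- q) (+ 2) ⟨
    ℤ.∣ (h ℤ.- q) ℤ.* + 2 ∣             ≡⟨ cong ℤ.∣_∣ (expand h q) ⟩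
    ℤ.∣ h ℤ.* + 2 ℤ.- q ℤ.* + 2 ∣       ≡⟨ cong (λ z → ℤ.∣ z ℤ.- q ℤ.* + 2 ∣) eq ⟩
    ℤ.∣ 1ℤ ℤ.+ q ℤ.* + 2 ℤ.- q ℤ.* + 2 ∣ ≡⟨ cong ℤ.∣_∣ (collapse (q ℤ.* + 2)) ⟩
    1                                    ∎
  even≢1 : ∀ m → ¬ (m ℕ.* 2 ≡ 1)
  even≢1 zero    ()
  even≢1 (suc m) ()
*2-cancel {suc (suc _)} h q (s≤s (s≤s ())) _

h*2/ℕ2 : ∀ h → (h ℤ.* + 2) /ℕ 2 ≡ h
h*2/ℕ2 h = sym (*2-cancel h _ (n%ℕd<d (h ℤ.* + 2) 2) (a≡a%ℕn+[a/ℕn]*n (h ℤ.* + 2) 2))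

0≤-[1+j]+d⇒2[1+j]≤2d : ∀ j d → 0ℤ ℤ.≤ -[1+ j ] ℤ.+ + d → suc j ℕ.* 2 ℕ.≤ 2 ℕ.* d
0≤-[1+j]+d⇒2[1+j]≤2d j d p = subst (ℕ._≤ 2 ℕ.* d) (ℕ.*-comm 2 (suc j)) (ℕ.*-monoʳ-≤ 2 {suc j} {d}
  (ℤ.drop‿+≤+ (ℤ.0≤i-j⇒j≤i (subst (0ℤ ℤ.≤_) (ℤ.+-comm -[1+ j ] (+ d)) p))))

-- For j ≤ 0 the left side is 0 by convention. The rising factorial on the right runs from 2j ≤ 0 to
-- 2(j + d) ≥ 0, so it contains the factor 0.
brack-ℤ : ∀ j d → 0ℤ ℤ.≤ j ℤ.+ + d → brack (j ℤ.+ + d) j ≡ value (j ℤ.* + 2) d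
brack-ℤ (+ zero)  d _ = sym (value-0 d z≤n)
brack-ℤ (+ suc j) d _ = trans (brack-value j d) (cong (λ a → value a d)
  (trans (cong +_ (ℕ.*-comm 2 (suc j))) (ℤ.pos-* (suc j) 2)))
brack-ℤ -[1+ j ]  d p = sym (value-0 d (0≤-[1+j]+d⇒2[1+j]≤2d j d p))

brace-ℤ : ∀ j d → 0ℤ ℤ.≤ j ℤ.+ + d → brace (j ℤ.+ + d) j ≡ value (j ℤ.* + 2 ℤ.+ 1ℤ) d
brace-ℤ (+ j) d _ = trans (brace-value j d) (cong (λ a → value a d)
  (trans (cong +_ (trans (cong suc (ℕ.*-comm 2 j)) (ℕ.+-comm 1 (j ℕ.* 2)))) (cong (ℤ._+ 1ℤ) (ℤ.pos-* j 2))))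
brace-ℤ -[1+ j ]  d p = sym (value-0 d (ℕ.≤-trans (ℕ.n≤1+n _) (0≤-[1+j]+d⇒2[1+j]≤2d j d p)))

regular⇒0≤h+n : ∀ {h n} → 0ℤ ℤ.⊔ (ℤ.- h) ℤ.≤ n → 0ℤ ℤ.≤ h ℤ.+ n
regular⇒0≤h+n {h} {n} p = subst (0ℤ ℤ.≤_) (swap h n) (ℤ.i≤j⇒0≤j-i (ℤ.≤-trans (ℤ.i≤j⊔i 0ℤ (ℤ.- h)) p))
  where
  swap : ∀ h n → n ℤ.- (ℤ.- h) ≡ h ℤ.+ n
  swap = ℤ.solve-∀

singular⇒n<-h : ∀ {h} n → ¬ (0ℤ ℤ.⊔ (ℤ.- h) ℤ.≤ + n) → + n ℤ.< ℤ.- h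
singular⇒n<-h n p = ℤ.≰⇒> λ -h≤n → p (ℤ.⊔-lub (ℤ.+≤+ z≤n) -h≤n)

-- In the regular branch the lower index is j = h + i and the rising factorial starts at 2j. In the
-- other branch it starts at 2k with k = -h - i - d and has the same length 2d + 1. Reversal moves
-- the start to 1 - 2k - (2d + 1) = 2h + 2i and cancels the minus sign.
evenCase-value : ∀ h i d → evenCase h (+ (i ℕ.+ d)) (+ i) ≡ value (h ℤ.* + 2 ℤ.+ + (2 ℕ.* i)) d
evenCase-value h i d = cases (0ℤ ℤ.⊔ (ℤ.- h) ℤ.≤? + (i ℕ.+ d))
  where
  cases : (p? : Dec (0ℤ ℤ.⊔ (ℤ.- h) ℤ.≤ + (i ℕ.+ d))) →
    (if ⌊ p? ⌋ then brack (h ℤ.+ + (i ℕ.+ d)) (h ℤ.+ + i)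
     else - brack (ℤ.- h ℤ.- + i) (ℤ.- h ℤ.- + (i ℕ.+ d))) ≡ value (h ℤ.* + 2 ℤ.+ + (2 ℕ.* i)) d
  cases (yes p) = begin
    brack (h ℤ.+ + (i ℕ.+ d)) j      ≡⟨ cong (λ N → brack N j) (sym (ℤ.+-assoc h (+ i) (+ d))) ⟩
    brack (j ℤ.+ + d) j              ≡⟨ brack-ℤ j d (subst (0ℤ ℤ.≤_) (sym (ℤ.+-assoc h (+ i) (+ d))) (regular⇒0≤h+n {h} p)) ⟩
    value (j ℤ.* + 2) d              ≡⟨ cong (λ a → value a d) (trans (double h (+ i)) (cong (λ z → h ℤ.* + 2 ℤ.+ z) (sym (ℤ.pos-* 2 i)))) ⟩
    value (h ℤ.* + 2 ℤ.+ + (2 ℕ.* i)) d ∎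
    where
    j = h ℤ.+ + i
    double : ∀ h i → (h ℤ.+ i) ℤ.* + 2 ≡ h ℤ.* + 2 ℤ.+ + 2 ℤ.* i
    double = ℤ.solve-∀
  cases (no ¬p) = begin
    - brack (ℤ.- h ℤ.- + i) k
      ≡⟨ cong (λ N → - brack N k) (top h (+ i) (+ d)) ⟩
    - brack (k ℤ.+ + d) k
      ≡⟨ cong -_ (brack-ℤ k d (ℤ.≤-trans (ℤ.i≤j⇒0≤j-i (ℤ.<⇒≤ n<-h)) (ℤ.i≤i+j k (+ d)))) ⟩
    - value (k ℤ.* + 2) d
      ≡⟨ value-reverse (k ℤ.* + 2) d ⟩
    value (1ℤ ℤ.- k ℤ.* + 2 ℤ.- + suc (2 ℕ.* d)) d
      ≡⟨ cong (λ a → value a d) (trans (cong (λ z → 1ℤ ℤ.- k ℤ.* + 2 ℤ.- (1ℤ ℤ.+ z)) (ℤ.pos-* 2 d))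
           (trans (reverse h (+ i) (+ d)) (cong (λ z → h ℤ.* + 2 ℤ.+ z) (sym (ℤ.pos-* 2 i))))) ⟩
    value (h ℤ.* + 2 ℤ.+ + (2 ℕ.* i)) d ∎
    where
    k = ℤ.- h ℤ.- + (i ℕ.+ d)
    n<-h = singular⇒n<-h {h} (i ℕ.+ d) ¬p
    top : ∀ h i d → ℤ.- h ℤ.- i ≡ ℤ.- h ℤ.- (i ℤ.+ d) ℤ.+ d
    top = ℤ.solve-∀
    reverse : ∀ h i d → 1ℤ ℤ.- (ℤ.- h ℤ.- (i ℤ.+ d)) ℤ.* + 2 ℤ.- (1ℤ ℤ.+ + 2 ℤ.* d) ≡ h ℤ.* + 2 ℤ.+ + 2 ℤ.* i
    reverse = ℤ.solve-∀

oddCase-value : ∀ h i d → oddCase h (h ℤ.+ 1ℤ) (+ (i ℕ.+ d)) (+ i) ≡ value (1ℤ ℤ.+ h ℤ.* + 2 ℤ.+ + (2 ℕ.* i)) d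
oddCase-value h i d = cases (0ℤ ℤ.⊔ (ℤ.- h) ℤ.≤? + (i ℕ.+ d))
  where
  cases : (p? : Dec (0ℤ ℤ.⊔ (ℤ.- h) ℤ.≤ + (i ℕ.+ d))) →
    (if ⌊ p? ⌋ then brace (h ℤ.+ + (i ℕ.+ d)) (h ℤ.+ + i)
     else - brace (ℤ.- (h ℤ.+ 1ℤ) ℤ.- + i) (ℤ.- (h ℤ.+ 1ℤ) ℤ.- + (i ℕ.+ d))) ≡ value (1ℤ ℤ.+ h ℤ.* + 2 ℤ.+ + (2 ℕ.* i)) d
  cases (yes p) = begin
    brace (h ℤ.+ + (i ℕ.+ d)) j      ≡⟨ cong (λ N → brace N j) (sym (ℤ.+-assoc h (+ i) (+ d))) ⟩
    brace (j ℤ.+ + d) j              ≡⟨ brace-ℤ j d (subst (0ℤ ℤ.≤_) (sym (ℤ.+-assoc h (+ i) (+ d))) (regular⇒0≤h+n {h} p)) ⟩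
    value (j ℤ.* + 2 ℤ.+ 1ℤ) d       ≡⟨ cong (λ a → value a d) (trans (double h (+ i)) (cong (λ z → 1ℤ ℤ.+ h ℤ.* + 2 ℤ.+ z) (sym (ℤ.pos-* 2 i)))) ⟩
    value (1ℤ ℤ.+ h ℤ.* + 2 ℤ.+ + (2 ℕ.* i)) d ∎
    where
    j = h ℤ.+ + i
    double : ∀ h i → (h ℤ.+ i) ℤ.* + 2 ℤ.+ 1ℤ ≡ 1ℤ ℤ.+ h ℤ.* + 2 ℤ.+ + 2 ℤ.* i
    double = ℤ.solve-∀
  cases (no ¬p) = begin
    - brace (ℤ.- (h ℤ.+ 1ℤ) ℤ.- + i) k
      ≡⟨ cong (λ N → - brace N k) (top h (+ i) (+ d)) ⟩
    - brace (k ℤ.+ + d) k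
      ≡⟨ cong -_ (brace-ℤ k d (ℤ.≤-trans 0≤k (ℤ.i≤i+j k (+ d)))) ⟩
    - value (k ℤ.* + 2 ℤ.+ 1ℤ) d
      ≡⟨ value-reverse (k ℤ.* + 2 ℤ.+ 1ℤ) d ⟩
    value (1ℤ ℤ.- (k ℤ.* + 2 ℤ.+ 1ℤ) ℤ.- + suc (2 ℕ.* d)) d
      ≡⟨ cong (λ a → value a d) (trans (cong (λ z → 1ℤ ℤ.- (k ℤ.* + 2 ℤ.+ 1ℤ) ℤ.- (1ℤ ℤ.+ z)) (ℤ.pos-* 2 d))
           (trans (reverse h (+ i) (+ d)) (cong (λ z → 1ℤ ℤ.+ h ℤ.* + 2 ℤ.+ z) (sym (ℤ.pos-* 2 i))))) ⟩
    value (1ℤ ℤ.+ h ℤ.* + 2 ℤ.+ + (2 ℕ.* i)) d ∎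
    where
    k = ℤ.- (h ℤ.+ 1ℤ) ℤ.- + (i ℕ.+ d)
    shuffle : ∀ h n → ℤ.- h ℤ.- (1ℤ ℤ.+ n) ≡ ℤ.- (h ℤ.+ 1ℤ) ℤ.- n
    shuffle = ℤ.solve-∀
    0≤k : 0ℤ ℤ.≤ k
    -- The strict inequality n < -h leaves room for the extra 1 in h + 1.
    0≤k = subst (0ℤ ℤ.≤_) (shuffle h (+ (i ℕ.+ d))) (ℤ.i≤j⇒0≤j-i (ℤ.i<j⇒suc[i]≤j (singular⇒n<-h {h} (i ℕ.+ d) ¬p)))
    top : ∀ h i d → ℤ.- (h ℤ.+ 1ℤ) ℤ.- i ≡ ℤ.- (h ℤ.+ 1ℤ) ℤ.- (i ℤ.+ d) ℤ.+ d
    top = ℤ.solve-∀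
    reverse : ∀ h i d → 1ℤ ℤ.- ((ℤ.- (h ℤ.+ 1ℤ) ℤ.- (i ℤ.+ d)) ℤ.* + 2 ℤ.+ 1ℤ) ℤ.- (1ℤ ℤ.+ + 2 ℤ.* d) ≡ 1ℤ ℤ.+ h ℤ.* + 2 ℤ.+ + 2 ℤ.* i
    reverse = ℤ.solve-∀

-- The remainder m is an argument of its own so that it can be matched on while r stays a variable.
byParity : ℕ → ℤ → ℤ → ℤ → ℚ
byParity m n i r = if ⌊ m ℕ.≟ 0 ⌋ then evenCase (r /ℕ 2) n i
  else oddCase ((r ℤ.- 1ℤ) /ℕ 2) ((r ℤ.+ 1ℤ) /ℕ 2) n i

choose-≤ : ∀ i d r → (+ (i ℕ.+ d)) choose (+ i) at r ≡ byParity (r %ℕ 2) (+ (i ℕ.+ d)) (+ i) r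
choose-≤ i d r = cong (λ b → if b then byParity (r %ℕ 2) (+ (i ℕ.+ d)) (+ i) r else 0ℚ)
  (⌊⌋-true (+ i ℤ.≤? + (i ℕ.+ d)) (ℤ.+≤+ (ℕ.m≤m+n i d)))

byParity-value : ∀ i d r m → m ℕ.< 2 → r ≡ + m ℤ.+ (r /ℕ 2) ℤ.* + 2 →
  byParity m (+ (i ℕ.+ d)) (+ i) r ≡ value (r ℤ.+ + (2 ℕ.* i)) d
byParity-value i d r 0 _ r≡ = trans (evenCase-value (r /ℕ 2) i d)
  (cong (λ a → value (a ℤ.+ + (2 ℕ.* i)) d) (sym (trans r≡ (ℤ.+-identityˡ ((r /ℕ 2) ℤ.* + 2)))))
byParity-value i d r 1 _ r≡ = begin
  oddCase ((r ℤ.- 1ℤ) /ℕ 2) ((r ℤ.+ 1ℤ) /ℕ 2) n (+ i)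
    ≡⟨ cong₂ (λ a b → oddCase a b n (+ i)) (halve { -1ℤ} {h} (pred-odd h)) (halve {1ℤ} {h ℤ.+ 1ℤ} (suc-odd h)) ⟩
  oddCase h (h ℤ.+ 1ℤ) n (+ i)
    ≡⟨ oddCase-value h i d ⟩
  value (1ℤ ℤ.+ h ℤ.* + 2 ℤ.+ + (2 ℕ.* i)) d
    ≡⟨ cong (λ a → value (a ℤ.+ + (2 ℕ.* i)) d) (sym r≡) ⟩
  value (r ℤ.+ + (2 ℕ.* i)) d ∎
  where
  h = r /ℕ 2
  n = + (i ℕ.+ d)
  pred-odd : ∀ h → 1ℤ ℤ.+ h ℤ.* + 2 ℤ.- 1ℤ ≡ h ℤ.* + 2
  pred-odd = ℤ.solve-∀
  suc-odd : ∀ h → 1ℤ ℤ.+ h ℤ.* + 2 ℤ.+ 1ℤ ≡ (h ℤ.+ 1ℤ) ℤ.* + 2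
  suc-odd = ℤ.solve-∀
  halve : ∀ {e k} → 1ℤ ℤ.+ h ℤ.* + 2 ℤ.+ e ≡ k ℤ.* + 2 → (r ℤ.+ e) /ℕ 2 ≡ k
  halve {e} {k} eq = trans (cong (λ z → z /ℕ 2) (trans (cong (λ z → z ℤ.+ e) r≡) eq)) (h*2/ℕ2 k)
byParity-value i d r (suc (suc _)) (s≤s (s≤s ())) _

choose-value : ∀ i d r → (+ (i ℕ.+ d)) choose (+ i) at r ≡ value (r ℤ.+ + (2 ℕ.* i)) d
choose-value i d r = trans (choose-≤ i d r)
  (byParity-value i d r (r %ℕ 2) (n%ℕd<d r 2) (a≡a%ℕn+[a/ℕn]*n r 2))

-- Stated for integer n because n - β and n - α in the theorem may be negative.
choose-> : ∀ {n i} r → n ℤ.< + i → n choose (+ i) at r ≡ 0ℚ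
choose-> { -[1+ n ]} r _ = refl
choose-> {+ n} {i} r n<i = cong (λ b → if b then byParity (r %ℕ 2) (+ n) (+ i) r else 0ℚ) (⌊⌋-false (+ i ℤ.≤? + n) (ℤ.<⇒≱ n<i))

-- Reindexing the double sum

-- Multiplication by the m-th power of the variable. A binomial with lower index i, as a series in
-- its upper index, has this form with m = i, so a product of two of them starts in degree α + β.
shifts : ℕ → PS → PS
shifts zero    f = f
shifts (suc m) f = shift (shifts m f)

shifts-cong : ∀ m {f g} → f ≋ g → shifts m f ≋ shifts m g
shifts-cong zero    p = p
shifts-cong (suc m) p = shift-cong (shifts-cong m p)

≋shifts : ∀ m {f g} → (∀ {k} → k ℕ.< m → f k ≡ 0ℚ) → (∀ k → f (m ℕ.+ k) ≡ g k) → f ≋ shifts m g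
≋shifts zero    low high k       = high k
≋shifts (suc m) low high zero    = low (s≤s z≤n)
≋shifts (suc m) low high (suc k) = ≋shifts m (λ k<m → low (s≤s k<m)) high k

shifts-< : ∀ {m k} f → k ℕ.< m → shifts m f k ≡ 0ℚ
shifts-< {suc m} {zero}  f _         = refl
shifts-< {suc m} {suc k} f (s≤s k<m) = shifts-< f k<m

shift-shifts : ∀ m f → shift (shifts m f) ≋ shifts m (shift f)
shift-shifts zero    f k = refl
shift-shifts (suc m) f k = shift-cong (shift-shifts m f) k

shifts-⋆ˡ : ∀ m f g → shifts m f ⋆ g ≋ shifts m (f ⋆ g)
shifts-⋆ˡ zero    f g k = refl
shifts-⋆ˡ (suc m) f g k = trans (shift-⋆ (shifts m f) g k) (shift-cong (shifts-⋆ˡ m f g) k)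

shifts-shifts : ∀ m n f → shifts m (shifts n f) ≡ shifts (m ℕ.+ n) f
shifts-shifts zero    n f = refl
shifts-shifts (suc m) n f = cong shift (shifts-shifts m n f)

shifts-⋆ : ∀ m n f g → shifts m f ⋆ shifts n g ≋ shifts (m ℕ.+ n) (f ⋆ g)
shifts-⋆ m n f g k = begin
  (shifts m f ⋆ shifts n g) k        ≡⟨ shifts-⋆ˡ m f (shifts n g) k ⟩
  shifts m (f ⋆ shifts n g) k        ≡⟨ shifts-cong m commuted k ⟩
  shifts m (shifts n (f ⋆ g)) k      ≡⟨ cong (λ h → h k) (shifts-shifts m n (f ⋆ g)) ⟩
  shifts (m ℕ.+ n) (f ⋆ g) k         ∎
  where
  commuted : f ⋆ shifts n g ≋ shifts n (f ⋆ g)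
  commuted k = trans (⋆-comm f (shifts n g) k) (trans (shifts-⋆ˡ n g f k) (shifts-cong n (⋆-comm g f) k))

sum-shifts : ∀ m d (D c : PS) →
  ∑[ k ≤ m ℕ.+ d ] (shifts m D (toℕ k) * c (toℕ k)) ≡ ∑[ k ≤ d ] (D (toℕ k) * c (m ℕ.+ toℕ k))
sum-shifts zero    d D c = refl
sum-shifts (suc m) d D c = begin
  0ℚ * c 0 + S     ≡⟨ cong (_+ S) (ℚ.*-zeroˡ (c 0)) ⟩
  0ℚ + S           ≡⟨ ℚ.+-identityˡ S ⟩
  S                ≡⟨ sum-shifts m d D (c ∘ suc) ⟩
  ∑[ k ≤ d ] (D (toℕ k) * c (suc m ℕ.+ toℕ k)) ∎
  where S = ∑[ k ≤ m ℕ.+ d ] (shifts m D (toℕ k) * c (suc (toℕ k)))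

-- f(x²)
stretch : PS → PS
stretch f zero          = f 0
stretch f (suc zero)    = 0ℚ
stretch f (suc (suc n)) = stretch (f ∘ suc) n

stretch-cong : ∀ {f g} → f ≋ g → stretch f ≋ stretch g
stretch-cong p zero          = p 0
stretch-cong p (suc zero)    = refl
stretch-cong p (suc (suc n)) = stretch-cong (p ∘ suc) n

stretch-⊞ : ∀ f g → stretch (f ⊞ g) ≋ stretch f ⊞ stretch g
stretch-⊞ f g zero          = refl
stretch-⊞ f g (suc zero)    = refl
stretch-⊞ f g (suc (suc n)) = stretch-⊞ (f ∘ suc) (g ∘ suc) n

stretch-• : ∀ a f → stretch (a • f) ≋ a • stretch f
stretch-• a f zero          = refl
stretch-• a f (suc zero)    = sym (ℚ.*-zeroʳ a)
stretch-• a f (suc (suc n)) = stretch-• a (f ∘ suc) n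

stretch-⋆ : ∀ f g → stretch f ⋆ stretch g ≋ stretch (f ⋆ g)
stretch-⋆ f g zero          = refl
stretch-⋆ f g (suc zero)    = begin
  f 0 * 0ℚ + (0ℚ * g 0 + 0ℚ)  ≡⟨ cong₂ (λ x y → x + (y + 0ℚ)) (ℚ.*-zeroʳ (f 0)) (ℚ.*-zeroˡ (g 0)) ⟩
  0ℚ                          ∎
stretch-⋆ f g (suc (suc n)) = begin
  f 0 * stretch (g ∘ suc) n + (0ℚ * stretch g (suc n) + rest)
    ≡⟨ cong (λ z → f 0 * stretch (g ∘ suc) n + z)
         (trans (cong (_+ rest) (ℚ.*-zeroˡ (stretch g (suc n)))) (ℚ.+-identityˡ rest)) ⟩
  f 0 * stretch (g ∘ suc) n + rest
    ≡⟨ cong₂ _+_ (sym (stretch-• (f 0) (g ∘ suc) n)) (stretch-⋆ (f ∘ suc) g n) ⟩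
  stretch (f 0 • (g ∘ suc)) n + stretch (f ∘ suc ⋆ g) n
    ≡⟨ stretch-⊞ (f 0 • (g ∘ suc)) (f ∘ suc ⋆ g) n ⟨
  stretch (f ⋆ g) (suc (suc n)) ∎
  where rest = (stretch (f ∘ suc) ⋆ stretch g) n

shift²-stretch : ∀ f → shift (shift (stretch f)) ≋ stretch (shift f)
shift²-stretch f zero          = refl
shift²-stretch f (suc zero)    = refl
shift²-stretch f (suc (suc n)) = refl

-- x f(x²) times x g(x²) is x² (fg)(x²). The factor x² is the origin of the condition ℓ + m = k - 1.
odd-⋆ : ∀ f g → shift (stretch f) ⋆ shift (stretch g) ≋ stretch (shift (f ⋆ g))
odd-⋆ f g n = begin
  (shift (stretch f) ⋆ shift (stretch g)) n   ≡⟨ shifts-⋆ 1 1 (stretch f) (stretch g) n ⟩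
  shift (shift (stretch f ⋆ stretch g)) n     ≡⟨ shifts-cong 2 (stretch-⋆ f g) n ⟩
  shift (shift (stretch (f ⋆ g))) n           ≡⟨ shift²-stretch (f ⋆ g) n ⟩
  stretch (shift (f ⋆ g)) n                   ∎

≋odd : ∀ f → (∀ k → f (2 ℕ.* k) ≡ 0ℚ) → f ≋ shift (stretch (λ k → f (suc (2 ℕ.* k))))
≋odd f even zero          = even 0
≋odd f even (suc zero)    = refl
≋odd f even (suc (suc n)) = trans
  (≋odd (λ k → f (suc (suc k))) (λ k → trans (cong f (sym (ℕ.*-suc 2 k))) (even (suc k))) n)
  (shift-tail n)
  where
  shift-tail : shift (stretch (λ k → f (suc (suc (suc (2 ℕ.* k)))))) ≋
    (λ n → shift (stretch (λ k → f (suc (2 ℕ.* k)))) (suc (suc n)))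
  shift-tail zero    = refl
  shift-tail (suc n) = stretch-cong (λ k → cong (f ∘ suc) (sym (ℕ.*-suc 2 k))) n

-- The degrees up to 2d + 1 form d + 1 pairs of an even and an odd one, and the odd ones contribute
-- zero.
sum-stretch : ∀ d (D c : PS) →
  ∑[ W ≤ suc (2 ℕ.* d) ] (stretch D (toℕ W) * c (toℕ W)) ≡ ∑[ k ≤ d ] (D (toℕ k) * c (2 ℕ.* toℕ k))
sum-stretch zero    D c = cong (λ z → D 0 * c 0 + (z + 0ℚ)) (ℚ.*-zeroˡ (c 1))
sum-stretch (suc d) D c = begin
  ∑[ W ≤ suc (2 ℕ.* suc d) ] (stretch D (toℕ W) * c (toℕ W))
    ≡⟨ cong (λ N → ∑[ W ≤ suc N ] (stretch D (toℕ W) * c (toℕ W))) (ℕ.*-suc 2 d) ⟩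
  D 0 * c 0 + (0ℚ * c 1 + S)
    ≡⟨ cong (λ z → D 0 * c 0 + z) (trans (cong (_+ S) (ℚ.*-zeroˡ (c 1))) (ℚ.+-identityˡ S)) ⟩
  D 0 * c 0 + S
    ≡⟨ cong (λ z → D 0 * c 0 + z) (sum-stretch d (D ∘ suc) (λ k → c (suc (suc k)))) ⟩
  D 0 * c 0 + ∑[ k ≤ d ] (D (suc (toℕ k)) * c (suc (suc (2 ℕ.* toℕ k))))
    ≡⟨ cong (λ z → D 0 * c 0 + z) (sum-cong-≗ {suc d} (λ k →
         cong (λ i → D (suc (toℕ k)) * c i) (sym (ℕ.*-suc 2 (toℕ k))))) ⟩
  ∑[ k ≤ suc d ] (D (toℕ k) * c (2 ℕ.* toℕ k)) ∎
  where S = ∑[ W ≤ suc (2 ℕ.* d) ] (stretch (D ∘ suc) (toℕ W) * c (suc (suc (toℕ W))))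

-- At k = 0 the sum is empty, in agreement with the zero constant term of a `shift`; for positive k
-- it is a convolution in degree k - 1.
inner-sum : ∀ c f g k → ∑[ ℓ < k ] (c * f (toℕ ℓ) * g (k ∸ 1 ∸ toℕ ℓ)) ≡ shift (f ⋆ g) k * c
inner-sum c f g zero    = sym (ℚ.*-zeroˡ c)
inner-sum c f g (suc k) = begin
  ∑[ ℓ ≤ k ] (c * f (toℕ ℓ) * g (k ∸ toℕ ℓ))
    ≡⟨ sum-cong-≗ {suc k} (λ ℓ → ℚ.*-assoc c (f (toℕ ℓ)) (g (k ∸ toℕ ℓ))) ⟩
  ∑[ ℓ ≤ k ] (c * (f (toℕ ℓ) * g (k ∸ toℕ ℓ)))
    ≡⟨ *-distribˡ-sum {suc k} c (λ ℓ → f (toℕ ℓ) * g (k ∸ toℕ ℓ)) ⟨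
  c * (f ⋆ g) k
    ≡⟨ ℚ.*-comm c ((f ⋆ g) k) ⟩
  (f ⋆ g) k * c ∎

-- Up to normalisation, B(a + p, b + q) for Euler's beta function B.
beta : ℤ → ℤ → ℕ → ℕ → ℕ → ℤ
beta a b p q w = rising a p ℤ.* rising b q ℤ.* rising (a ℤ.+ b ℤ.+ + (p ℕ.+ q)) w

-- The first factor of the third rising factorial splits as a + b + p + q = (a + p) + (b + q), and
-- the two summands are the next factors of the first and the second.
beta-pascal : ∀ a b p q w → beta a b p q (suc w) ≡ beta a b (suc p) q w ℤ.+ beta a b p (suc q) w
beta-pascal a b p q w = begin
  A ℤ.* B ℤ.* (x ℤ.* rising (ℤ.suc x) w)
    ≡⟨ cong (λ y → A ℤ.* B ℤ.* (x ℤ.* rising y w)) (suc-inside (a ℤ.+ b) (+ (p ℕ.+ q))) ⟩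
  A ℤ.* B ℤ.* (x ℤ.* R)
    ≡⟨ split a b (+ p) (+ q) A B R ⟩
  A ℤ.* (a ℤ.+ + p) ℤ.* B ℤ.* R ℤ.+ A ℤ.* (B ℤ.* (b ℤ.+ + q)) ℤ.* R
    ≡⟨ cong₂ (λ y z → y ℤ.* B ℤ.* R ℤ.+ A ℤ.* z ℤ.* R) (rising-last a p) (rising-last b q) ⟨
  beta a b (suc p) q w ℤ.+ A ℤ.* rising b (suc q) ℤ.* R
    ≡⟨ cong (λ m → beta a b (suc p) q w ℤ.+ A ℤ.* rising b (suc q) ℤ.* rising (a ℤ.+ b ℤ.+ + m) w) (ℕ.+-suc p q) ⟨
  beta a b (suc p) q w ℤ.+ beta a b p (suc q) w ∎
  where
  A = rising a p
  B = rising b q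
  x = a ℤ.+ b ℤ.+ + (p ℕ.+ q)
  R = rising (a ℤ.+ b ℤ.+ + suc (p ℕ.+ q)) w
  suc-inside : ∀ x y → 1ℤ ℤ.+ (x ℤ.+ y) ≡ x ℤ.+ (1ℤ ℤ.+ y)
  suc-inside = ℤ.solve-∀
  split : ∀ a b p q A B R → A ℤ.* B ℤ.* ((a ℤ.+ b ℤ.+ (p ℤ.+ q)) ℤ.* R) ≡
    A ℤ.* (a ℤ.+ p) ℤ.* B ℤ.* R ℤ.+ A ℤ.* (B ℤ.* (b ℤ.+ q)) ℤ.* R
  split = ℤ.solve-∀

-- Oddness of T leaves p = 2ℓ + 1 and q = 2m + 1. Hence W = 2k with k = ℓ + m + 1, and w = M - W =
-- 2(d - k) + 1, so each of the three factors is again a `value`.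
value-identity : ∀ a b d → value a d + value b d ≡
  value (a ℤ.+ b) d + ∑[ k ≤ d ] (shift (value a ⋆ value b) (toℕ k) * value (a ℤ.+ b ℤ.+ + (2 ℕ.* toℕ k)) (d ∸ toℕ k))
value-identity a b d = begin
  value a d + value b d
    ≡⟨ cong₂ (λ x y → T M * fromℤ x + T M * fromℤ y) (F-M00 (rising a M)) (F-0M0 (rising b M)) ⟨
  T M * F M 0 0 + T M * F 0 M 0
    ≡⟨ TanhPascal.tanh½-pascal F F-pascal M ⟩
  T M * F 0 0 M + ∑[ W ≤ M ] (∑[ p ≤ toℕ W ] term (toℕ W) (toℕ p))
    ≡⟨ cong₂ _+_ (cong (λ z → T M * fromℤ z) F-00M) (sum-cong-≗ {suc M} collect) ⟩
  value (a ℤ.+ b) d + ∑[ W ≤ M ] (stretch D (toℕ W) * c (toℕ W))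
    ≡⟨ cong (λ z → value (a ℤ.+ b) d + z) (sum-stretch d D c) ⟩
  value (a ℤ.+ b) d + ∑[ k ≤ d ] (D (toℕ k) * c (2 ℕ.* toℕ k))
    ≡⟨ cong (λ z → value (a ℤ.+ b) d + z) (sum-cong-≗ {suc d} λ k → cong (D (toℕ k) *_) (c-even (toℕ k) (toℕ≤pred[n] k))) ⟩
  value (a ℤ.+ b) d + ∑[ k ≤ d ] (D (toℕ k) * value (a ℤ.+ b ℤ.+ + (2 ℕ.* toℕ k)) (d ∸ toℕ k)) ∎
  where
  M = suc (2 ℕ.* d)
  T = tanh½
  D = shift (value a ⋆ value b)

  F : ℕ → ℕ → ℕ → ℚ
  F p q w = fromℤ (beta a b p q w)

  F-pascal : Pascal F
  F-pascal p q w = trans (cong fromℤ (beta-pascal a b p q w)) (fromℤ-homo-+ (beta a b (suc p) q w) (beta a b p (suc q) w))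

  F-M00 : ∀ x → x ℤ.* 1ℤ ℤ.* 1ℤ ≡ x
  F-M00 = ℤ.solve-∀

  F-0M0 : ∀ x → 1ℤ ℤ.* x ℤ.* 1ℤ ≡ x
  F-0M0 = ℤ.solve-∀

  F-00M : 1ℤ ℤ.* 1ℤ ℤ.* rising (a ℤ.+ b ℤ.+ + 0) M ≡ rising (a ℤ.+ b) M
  F-00M = trans (ℤ.*-identityˡ (rising (a ℤ.+ b ℤ.+ + 0) M)) (cong (λ x → rising x M) (ℤ.+-identityʳ (a ℤ.+ b)))

  c : ℕ → ℚ
  c W = T (M ∸ W) * fromℤ (rising (a ℤ.+ b ℤ.+ + W) (M ∸ W))

  c-even : ∀ k → k ℕ.≤ d → c (2 ℕ.* k) ≡ value (a ℤ.+ b ℤ.+ + (2 ℕ.* k)) (d ∸ k)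
  c-even k k≤d = cong (λ m → T m * fromℤ (rising (a ℤ.+ b ℤ.+ + (2 ℕ.* k)) m))
    (trans (ℕ.+-∸-assoc 1 (ℕ.*-monoʳ-≤ 2 k≤d)) (cong suc (sym (ℕ.*-distribˡ-∸ 2 d k))))

  term : ℕ → ℕ → ℚ
  term W p = T p * T (W ∸ p) * T (M ∸ W) * F p (W ∸ p) (M ∸ W)

  weighted : ℤ → PS
  weighted x p = T p * fromℤ (rising x p)

  weighted≋ : ∀ x → weighted x ≋ shift (stretch (value x))
  weighted≋ x = ≋odd (weighted x) λ k →
    trans (cong (_* fromℤ (rising x (2 ℕ.* k))) (tanh½-even k)) (ℚ.*-zeroˡ (fromℤ (rising x (2 ℕ.* k))))

  regroup : ∀ t u v x y z → t * u * v * (x * y * z) ≡ t * x * (u * y) * (v * z)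
  regroup = solve 6 (λ t u v x y z → t :* u :* v :* (x :* y :* z) := t :* x :* (u :* y) :* (v :* z)) refl
    where open SemiringSolver ℚ-semiring

  -- The last factor of `beta` depends on p and q only through p + q = W, so it can leave the inner
  -- sum, and a plain convolution remains.
  term-split : ∀ W p → p ℕ.≤ W → term W p ≡ weighted a p * weighted b (W ∸ p) * c W
  term-split W p p≤W = begin
    T p * T (W ∸ p) * T (M ∸ W) * fromℤ (X ℤ.* Y ℤ.* rising (a ℤ.+ b ℤ.+ + (p ℕ.+ (W ∸ p))) (M ∸ W))
      ≡⟨ cong (λ m → T p * T (W ∸ p) * T (M ∸ W) * fromℤ (X ℤ.* Y ℤ.* rising (a ℤ.+ b ℤ.+ + m) (M ∸ W))) (ℕ.m+[n∸m]≡n p≤W) ⟩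
    T p * T (W ∸ p) * T (M ∸ W) * fromℤ (X ℤ.* Y ℤ.* Z)
      ≡⟨ cong (T p * T (W ∸ p) * T (M ∸ W) *_) (trans (fromℤ-homo-* (X ℤ.* Y) Z) (cong (_* fromℤ Z) (fromℤ-homo-* X Y))) ⟩
    T p * T (W ∸ p) * T (M ∸ W) * (fromℤ X * fromℤ Y * fromℤ Z)
      ≡⟨ regroup (T p) (T (W ∸ p)) (T (M ∸ W)) (fromℤ X) (fromℤ Y) (fromℤ Z) ⟩
    weighted a p * weighted b (W ∸ p) * c W ∎
    where
    X = rising a p
    Y = rising b (W ∸ p)
    Z = rising (a ℤ.+ b ℤ.+ + W) (M ∸ W)

  collect : (W : Fin (suc M)) → ∑[ p ≤ toℕ W ] term (toℕ W) (toℕ p) ≡ stretch D (toℕ W) * c (toℕ W)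
  collect W′ = begin
    ∑[ p ≤ W ] term W (toℕ p)
      ≡⟨ sum-cong-≗ {suc W} (λ p → term-split W (toℕ p) (toℕ≤pred[n] p)) ⟩
    ∑[ p ≤ W ] (weighted a (toℕ p) * weighted b (W ∸ toℕ p) * c W)
      ≡⟨ *-distribʳ-sum {suc W} (c W) (λ p → weighted a (toℕ p) * weighted b (W ∸ toℕ p)) ⟨
    (weighted a ⋆ weighted b) W * c W
      ≡⟨ cong (_* c W) (trans (⋆-cong (weighted≋ a) (weighted≋ b) W) (odd-⋆ (value a) (value b) W)) ⟩
    stretch D W * c W ∎
    where W = toℕ W′

-- From closed forms back to the binomials

choose≋shifts : ∀ i r → (λ n → (+ n) choose (+ i) at r) ≋ shifts i (value (r ℤ.+ + (2 ℕ.* i)))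
choose≋shifts i r = ≋shifts i (λ n<i → choose-> r (ℤ.+<+ n<i)) (λ d → choose-value i d r)

doubleSum : ℕ → PS → PS → PS → ℚ
doubleSum n c f g = ∑[ k ≤ n ] (∑[ ℓ < toℕ k ] (c (toℕ k) * f (toℕ ℓ) * g (toℕ k ∸ 1 ∸ toℕ ℓ)))

module _ α β (f g F G : PS) (f≋ : f ≋ shifts α F) (g≋ : g ≋ shifts β G) where

  doubleSum-shifts : ∀ n c →
    doubleSum n c f g ≡ ∑[ k ≤ n ] (shifts (α ℕ.+ β) (shift (F ⋆ G)) (toℕ k) * c (toℕ k))
  doubleSum-shifts n c = sum-cong-≗ {suc n} λ k → trans
    (inner-sum (c (toℕ k)) f g (toℕ k))
    (cong (_* c (toℕ k)) (trans
      (shift-cong (λ i → trans (⋆-cong f≋ g≋ i) (shifts-⋆ α β F G i)) (toℕ k))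
      (shift-shifts (α ℕ.+ β) (F ⋆ G) (toℕ k))))

  doubleSum-< : ∀ n c → n ℕ.< α ℕ.+ β → doubleSum n c f g ≡ 0ℚ
  doubleSum-< n c n<α+β = begin
    doubleSum n c f g
      ≡⟨ doubleSum-shifts n c ⟩
    ∑[ k ≤ n ] (shifts (α ℕ.+ β) (shift (F ⋆ G)) (toℕ k) * c (toℕ k))
      ≡⟨ sum-cong-≗ {suc n} (λ k → trans
           (cong (_* c (toℕ k)) (shifts-< (shift (F ⋆ G)) (ℕ.≤-<-trans (toℕ≤pred[n] k) n<α+β)))
           (ℚ.*-zeroˡ (c (toℕ k)))) ⟩
    ∑[ k ≤ n ] 0ℚ
      ≡⟨ sum-replicate-zero (suc n) ⟩
    0ℚ ∎

  doubleSum-+ : ∀ d c →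
    doubleSum (α ℕ.+ β ℕ.+ d) c f g ≡ ∑[ k ≤ d ] (shift (F ⋆ G) (toℕ k) * c (α ℕ.+ β ℕ.+ toℕ k))
  doubleSum-+ d c = begin
    doubleSum n c f g
      ≡⟨ doubleSum-shifts n c ⟩
    ∑[ k ≤ n ] (shifts (α ℕ.+ β) (shift (F ⋆ G)) (toℕ k) * c (toℕ k))
      ≡⟨ sum-shifts (α ℕ.+ β) d (shift (F ⋆ G)) c ⟩
    ∑[ k ≤ d ] (shift (F ⋆ G) (toℕ k) * c (α ℕ.+ β ℕ.+ toℕ k)) ∎
    where n = α ℕ.+ β ℕ.+ d

doubleSum-value : ∀ a b d α β (c f g : PS) →
  f ≋ shifts α (value a) → g ≋ shifts β (value b) →
  (∀ k → k ℕ.≤ d → c (α ℕ.+ β ℕ.+ k) ≡ value (a ℤ.+ b ℤ.+ + (2 ℕ.* k)) (d ∸ k)) →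
  value a d + value b d ≡ c (α ℕ.+ β) + doubleSum (α ℕ.+ β ℕ.+ d) c f g
doubleSum-value a b d α β c f g f≋ g≋ c≡ = begin
  value a d + value b d
    ≡⟨ value-identity a b d ⟩
  value (a ℤ.+ b) d + ∑[ k ≤ d ] (D (toℕ k) * value (a ℤ.+ b ℤ.+ + (2 ℕ.* toℕ k)) (d ∸ toℕ k))
    ≡⟨ cong₂ _+_ top (sum-cong-≗ {suc d} λ k → cong (D (toℕ k) *_) (c≡ (toℕ k) (toℕ≤pred[n] k))) ⟨
  c m + ∑[ k ≤ d ] (D (toℕ k) * c (m ℕ.+ toℕ k))
    ≡⟨ cong (λ z → c m + z) (doubleSum-+ α β f g (value a) (value b) f≋ g≋ d c) ⟨
  c m + doubleSum (m ℕ.+ d) c f g ∎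
  where
  m = α ℕ.+ β
  D = shift (value a ⋆ value b)
  top : c m ≡ value (a ℤ.+ b) d
  top = begin
    c m                        ≡⟨ cong c (ℕ.+-identityʳ m) ⟨
    c (m ℕ.+ 0)                ≡⟨ c≡ 0 z≤n ⟩
    value (a ℤ.+ b ℤ.+ + 0) d  ≡⟨ cong (λ x → value x d) (ℤ.+-identityʳ (a ℤ.+ b)) ⟩
    value (a ℤ.+ b) d          ∎

module _ (α β : ℕ) (r s : ℤ) where
  private
    m = α ℕ.+ β

    c : ℕ → PS
    c n k = (+ n) choose (+ k) at (r ℤ.+ s)

    f g : PS
    f k = (+ k) choose (+ α) at r
    g k = (+ k) choose (+ β) at s

    a b : ℤ
    a = r ℤ.+ + (2 ℕ.* α)
    b = s ℤ.+ + (2 ℕ.* β)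

    argument : ∀ k → r ℤ.+ s ℤ.+ + (2 ℕ.* (m ℕ.+ k)) ≡ a ℤ.+ b ℤ.+ + (2 ℕ.* k)
    argument k = begin
      r ℤ.+ s ℤ.+ + (2 ℕ.* (m ℕ.+ k))                     ≡⟨ cong (λ z → r ℤ.+ s ℤ.+ + z) (expand α β k) ⟩
      r ℤ.+ s ℤ.+ + (2 ℕ.* α ℕ.+ 2 ℕ.* β ℕ.+ 2 ℕ.* k)     ≡⟨ collect r s (+ (2 ℕ.* α)) (+ (2 ℕ.* β)) (+ (2 ℕ.* k)) ⟩
      a ℤ.+ b ℤ.+ + (2 ℕ.* k)                             ∎
      where
      expand : ∀ α β k → 2 ℕ.* (α ℕ.+ β ℕ.+ k) ≡ 2 ℕ.* α ℕ.+ 2 ℕ.* β ℕ.+ 2 ℕ.* k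
      expand = ℕ.solve-∀
      collect : ∀ r s x y z → r ℤ.+ s ℤ.+ (x ℤ.+ y ℤ.+ z) ≡ r ℤ.+ x ℤ.+ (s ℤ.+ y) ℤ.+ z
      collect = ℤ.solve-∀

    c-value : ∀ d k → k ℕ.≤ d → c (m ℕ.+ d) (m ℕ.+ k) ≡ value (a ℤ.+ b ℤ.+ + (2 ℕ.* k)) (d ∸ k)
    c-value d k k≤d = begin
      c (m ℕ.+ d) (m ℕ.+ k)
        ≡⟨ cong (λ z → c z (m ℕ.+ k)) (trans (cong (m ℕ.+_) (sym (ℕ.m+[n∸m]≡n k≤d))) (sym (ℕ.+-assoc m k (d ∸ k)))) ⟩
      c (m ℕ.+ k ℕ.+ (d ∸ k)) (m ℕ.+ k)
        ≡⟨ choose-value (m ℕ.+ k) (d ∸ k) (r ℤ.+ s) ⟩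
      value (r ℤ.+ s ℤ.+ + (2 ℕ.* (m ℕ.+ k))) (d ∸ k)
        ≡⟨ cong (λ x → value x (d ∸ k)) (argument k) ⟩
      value (a ℤ.+ b ℤ.+ + (2 ℕ.* k)) (d ∸ k) ∎

    below : ∀ {n} α β → n ℕ.< α ℕ.+ β → + n ℤ.- + β ℤ.< + α
    below {n} α β n<α+β = subst (+ n ℤ.- + β ℤ.<_) (cancel (+ α) (+ β)) (ℤ.+-monoˡ-< (ℤ.- (+ β)) (ℤ.+<+ n<α+β))
      where
      cancel : ∀ x y → x ℤ.+ y ℤ.- y ≡ x
      cancel = ℤ.solve-∀

  -- Everything vanishes: n - β < α, n - α < β and n < α + β, and every k ≤ n lies below degree α +
  -- β, before which the convolution in the double sum is zero.
  choose-identity-< : ∀ n → n ℕ.< m →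
    (+ n ℤ.- + β) choose (+ α) at r + (+ n ℤ.- + α) choose (+ β) at s ≡ c n m + doubleSum n (c n) f g
  choose-identity-< n n<m = trans
    (cong₂ _+_ (choose-> r (below α β n<m)) (choose-> s (below β α (subst (n ℕ.<_) (ℕ.+-comm α β) n<m))))
    (sym (cong₂ _+_ (choose-> (r ℤ.+ s) (ℤ.+<+ n<m))
                    (doubleSum-< α β f g (value a) (value b) (choose≋shifts α r) (choose≋shifts β s) n (c n) n<m)))

  -- Here n - β = α + d and n - α = β + d, so both binomials on the left have the same excess d of
  -- upper over lower index.
  choose-identity-+ : ∀ d →
    (+ (m ℕ.+ d) ℤ.- + β) choose (+ α) at r + (+ (m ℕ.+ d) ℤ.- + α) choose (+ β) at s ≡
    c (m ℕ.+ d) m + doubleSum (m ℕ.+ d) (c (m ℕ.+ d)) f g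
  choose-identity-+ d = trans
    (cong₂ _+_
      (trans (cong (λ x → x choose (+ α) at r) (minus-β (+ α) (+ β) (+ d))) (choose-value α d r))
      (trans (cong (λ x → x choose (+ β) at s) (minus-α (+ α) (+ β) (+ d))) (choose-value β d s)))
    (doubleSum-value a b d α β (c (m ℕ.+ d)) f g (choose≋shifts α r) (choose≋shifts β s) (c-value d))
    where
    minus-β : ∀ x y z → x ℤ.+ y ℤ.+ z ℤ.- y ≡ x ℤ.+ z
    minus-β = ℤ.solve-∀
    minus-α : ∀ x y z → x ℤ.+ y ℤ.+ z ℤ.- x ≡ y ℤ.+ z
    minus-α = ℤ.solve-∀

  choose-identity : ∀ n → Dec (m ℕ.≤ n) →
    (+ n ℤ.- + β) choose (+ α) at r + (+ n ℤ.- + α) choose (+ β) at s ≡ c n m + doubleSum n (c n) f g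
  choose-identity n (yes m≤n) = subst
    (λ n → (+ n ℤ.- + β) choose (+ α) at r + (+ n ℤ.- + α) choose (+ β) at s ≡ c n m + doubleSum n (c n) f g)
    (ℕ.m+[n∸m]≡n m≤n) (choose-identity-+ (n ∸ m))
  choose-identity n (no  m≰n) = choose-identity-< n (ℕ.≰⇒> m≰n)

theorem6p1 : (n α β : ℕ) (r s : ℤ) →
    (+ n ℤ.- + β) choose (+ α) at r + (+ n ℤ.- + α) choose (+ β) at s
    ≡ (+ n) choose (+ (α ℕ.+ β)) at (r ℤ.+ s)
    + ∑[ k ≤ n ] (∑[ ℓ < toℕ k ]
    ((+ n) choose (+ toℕ k) at (r ℤ.+ s)
    * (+ toℕ ℓ) choose (+ α) at r
    * (+ (toℕ k ∸ 1 ∸ toℕ ℓ)) choose (+ β) at s))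
theorem6p1 n α β r s = choose-identity α β r s n (α ℕ.+ β ℕ.≤? n)
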